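{- For every integer $r\geq 3$, we have $g_r([n])= \left(\binom{r}{2}+o(1)\right) 2^{n}$ as $n\to\infty$. Moreover, all but an $o(1)$ proportion (as $n\to\infty$) of the rainbow 3-AP-free $r$-colorings of $[n]$ are 2-colorings, i.e. use at most two of the $r$ colors.
   Context: $[n]=\{1,2,\ldots,n\}$. A 3-term arithmetic progression (3-AP) of $[n]$ is a sequence $a, a+d, a+2d$ of elements of $[n]$ with $d\in[n]$ (so $d\ge 1$). An $r$-coloring of $[n]$ is any map $c\colon [n]\to[r]$ (not necessarily surjective). A 3-AP is rainbow under $c$ if its three terms have pairwise distinct colors; $c$ is rainbow 3-AP-free if no 3-AP of $[n]$ is rainbow. $g_r([n])$ denotes the number of rainbow 3-AP-free $r$-colorings of $[n]$. The asymptotics are for fixed $r$. -}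

module Defs where

open import Data.Fin.Base using (Fin; toℕ)
open import Data.Fin.Properties using (all?; any?) renaming (_≟_ to _≟ᶠ_)
import Data.Integer.Base as ℤ
open import Data.List.Base using (List; []; _∷_; length; filter; allFin; cartesianProductWith)
open import Data.Nat.Base using (ℕ; zero; suc; _+_; _*_; _≤_; _≥_)
open import Data.Nat.Properties using (_≟_; _≤?_)
open import Data.Product.Base using (∃; _×_)
open import Data.Rational.Base as ℚ using (ℚ; 0ℚ)
open import Data.Vec.Base as Vec using (Vec; lookup)
open import Relation.Binary.PropositionalEquality using (_≡_; _≢_)
open import Relation.Nullary using (¬_; Dec)
open import Relation.Nullary.Decidable using (_×-dec_; _→-dec_; ¬?)

-- `Fin n` stands for [n] = {1, …, n}; `val i` is the integer that `i` stands for.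
val : ∀ {n} → Fin n → ℕ
val i = suc (toℕ i)

-- `lookup` identifies such a vector with the map Fin n → Fin r it tabulates;
-- vectors make equality of colorings propositional equality.
Coloring : ℕ → ℕ → Set
Coloring r n = Vec (Fin r) n

Is3AP : ∀ {n} → Fin n → Fin n → Fin n → Set
Is3AP {n} x y z = ∃ λ (d : Fin n) → val y ≡ val x + val d × val z ≡ val x + 2 * val d

Rainbow : ∀ {r n} → Coloring r n → Fin n → Fin n → Fin n → Set
Rainbow c x y z =
  lookup c x ≢ lookup c y × lookup c y ≢ lookup c z × lookup c x ≢ lookup c z

Rainbow3APFree : ∀ {r n} → Coloring r n → Set
Rainbow3APFree c = ∀ x y z → Is3AP x y z → ¬ Rainbow c x y z

usedColors : ∀ {r n} → Coloring r n → List (Fin r)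
usedColors {r} c = filter (λ k → any? (λ x → lookup c x ≟ᶠ k)) (allFin r)

TwoColoring : ∀ {r n} → Coloring r n → Set
TwoColoring c = length (usedColors c) ≤ 2

is3AP? : ∀ {n} (x y z : Fin n) → Dec (Is3AP x y z)
is3AP? x y z =
  any? λ d → (val y ≟ val x + val d) ×-dec (val z ≟ val x + 2 * val d)

rainbow? : ∀ {r n} (c : Coloring r n) (x y z : Fin n) → Dec (Rainbow c x y z)
rainbow? c x y z =
  ¬? (lookup c x ≟ᶠ lookup c y) ×-dec
  ¬? (lookup c y ≟ᶠ lookup c z) ×-dec
  ¬? (lookup c x ≟ᶠ lookup c z)

rainbow3APFree? : ∀ {r n} (c : Coloring r n) → Dec (Rainbow3APFree c)
rainbow3APFree? c =
  all? λ x → all? λ y → all? λ z → is3AP? x y z →-dec ¬? (rainbow? c x y z)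

twoColoring? : ∀ {r n} (c : Coloring r n) → Dec (TwoColoring c)
twoColoring? c = length (usedColors c) ≤? 2

-- Every coloring occurs exactly once.
allColorings : ∀ r n → List (Coloring r n)
allColorings r zero    = Vec.[] ∷ []
allColorings r (suc n) = cartesianProductWith Vec._∷_ (allFin r) (allColorings r n)

rainbow3APFreeColorings : ∀ r n → List (Coloring r n)
rainbow3APFreeColorings r n = filter rainbow3APFree? (allColorings r n)

-- g r n is g_r([n]).
g : ℕ → ℕ → ℕ
g r n = length (rainbow3APFreeColorings r n)

-- The number of rainbow 3-AP-free colorings that use at least three colors.
gNonTwo : ℕ → ℕ → ℕ
gNonTwo r n =
  length (filter (λ c → ¬? (twoColoring? c)) (rainbow3APFreeColorings r n))

fromℕ : ℕ → ℚ
fromℕ m = (ℤ.+ m) ℚ./ 1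

-- e(n) = o(1) as n → ∞.  The error terms considered are quotients of integers,
-- so rational sequences suffice; every positive real exceeds a positive rational,
-- so rational ε suffice too.
IsLittleO1 : (ℕ → ℚ) → Set
IsLittleO1 e = ∀ (ε : ℚ) → 0ℚ ℚ.< ε → ∃ λ N → ∀ n → n ≥ N → ℚ.∣ e n ∣ ℚ.< ε

{-# OPTIONS --safe #-}
module Submission where

-- A coloring is built letter by letter to the left.  A new letter at distance 1 + j from a
-- rainbow 3-AP-free word v lies, for every i, on a 3-AP with v(i) and v(1 + j + 2i).  If
-- two such entries have different colors, the letter must take one of these two colors;
-- if all pairs v(i), v(1 + j + 2i) are monochromatic, v is determined by about half of its
-- entries, which form a rainbow 3-AP-free word themselves.  This exceptional case is
-- negligible, so g(n + 1) ≤ 2 g(n) + O(g(n / 2)), whence g(n) = O(3ⁿ) and the exceptional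
-- words number O(3^(n/2)).
-- Otherwise the next three letters are confined to 2-sets P₀, P₁, P₂ of colors of v.  If v
-- has at least three colors, P₀ and P₁ can be chosen different, because the pairs
-- i, 1 + 2i and i, 2 + 2i connect all positions.  Then P₀, P₁, P₂ have distinct
-- representatives, which would form a rainbow 3-AP, so at most 7 of the 8 extensions
-- survive and the colorings with at least three colors number O(7^(n/3)) = o(2ⁿ).

open import Defs
open import Data.Fin.Base using (Fin; toℕ; zero; suc; fromℕ<)
import Data.Fin.Base as Fin
open import Data.Fin.Properties using (all?; any?; ¬∀⟶∃¬; toℕ-injective; toℕ<n; toℕ-fromℕ<; toℕ-fromℕ)
  renaming (_≟_ to _≟ᶠ_)
import Data.Integer.Base as ℤ
import Data.Integer.Properties as ℤ
open import Data.List.Base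
  using (List; []; _∷_; _++_; map; filter; length; allFin; cartesianProduct; cartesianProductWith)
open import Data.List.Membership.Propositional using (_∈_)
open import Data.List.Membership.Propositional.Properties
  using (∈-∃++; ∈-++⁻; ∈-++⁺ˡ; ∈-++⁺ʳ; ∈-filter⁺; ∈-filter⁻; ∈-allFin; ∈-map⁻; ∈-length;
         ∈-cartesianProductWith⁺; ∈-cartesianProduct⁺)
open import Data.List.Properties using (map-∘; map-++; length-++; length-map; length-tabulate)
open import Data.List.Relation.Binary.Subset.Propositional using (_⊆_)
open import Data.List.Relation.Unary.All as All using ([]; _∷_)
open import Data.List.Relation.Unary.AllPairs using ([]; _∷_)
open import Data.List.Relation.Unary.Any using (here; there)
open import Data.List.Relation.Unary.Unique.Propositional using (Unique)
import Data.List.Relation.Unary.Unique.Propositional.Properties as Uniq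
open import Data.Nat.Base as Nat hiding (_+_; _*_)
open import Data.Nat.Combinatorics using (_C_; nC1≡n; nCk+nC[k+1]≡[n+1]C[k+1])
open import Data.Nat.DivMod using (m≡m%n+[m/n]*n; m%n<n; /-monoˡ-≤; m*n/n≡m)
open import Data.Nat.Induction using (<-rec)
open import Data.Nat.ListAction using (sum)
open import Data.Nat.ListAction.Properties using (sum-++)
open import Data.Nat.Properties
open import Data.Nat.Tactic.RingSolver using (solve-∀)
open import Data.Product.Base using (∃; ∃-syntax; _×_; _,_; proj₁; proj₂)
import Data.Rational.Base as ℚ
import Data.Rational.Properties as ℚ
import Data.Rational.Unnormalised.Base as ℚᵘ
import Data.Rational.Unnormalised.Properties as ℚᵘ
open import Data.Sum.Base as Sum using (_⊎_; inj₁; inj₂; [_,_]′)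
open import Data.Vec.Base as Vec using (lookup; tabulate)
open import Data.Vec.Properties
  using (∷-injective; lookup∘tabulate; tabulate∘lookup; tabulate-cong; lookup-replicate)
open import Function.Base using (_∘_; id)
open import Relation.Binary.PropositionalEquality
open import Relation.Nullary using (¬_; Dec; yes; no; contradiction)
open import Relation.Nullary.Decidable using (_→-dec_; _×-dec_; _⊎-dec_; ¬?; decidable-stable)
open import Relation.Unary using (Pred; Decidable)

-- Counting with sums of indicators and with injections

module Counting where
  open Nat using (_+_; _*_)
  private variable
    A B C : Set

  -- Cardinalities of filtered lists become sums of indicators, so that a bound valid for each word
  -- can be summed over all words.
  𝟙 : {P : Set} → Dec P → ℕ
  𝟙 (yes _) = 1
  𝟙 (no  _) = 0

  𝟙≤1 : {P : Set} (d : Dec P) → 𝟙 d ≤ 1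
  𝟙≤1 (yes _) = ≤-refl
  𝟙≤1 (no  _) = z≤n

  𝟙-yes : {P : Set} (d : Dec P) → P → 𝟙 d ≡ 1
  𝟙-yes (yes _) _ = refl
  𝟙-yes (no ¬p) p = contradiction p ¬p

  𝟙-no : {P : Set} (d : Dec P) → ¬ P → 𝟙 d ≡ 0
  𝟙-no (yes p) ¬p = contradiction p ¬p
  𝟙-no (no _)  _  = refl

  ∑ : List A → (A → ℕ) → ℕ
  ∑ xs w = sum (map w xs)

  ∑-cong : ∀ (xs : List A) {v w : A → ℕ} → (∀ x → v x ≡ w x) → ∑ xs v ≡ ∑ xs w
  ∑-cong []       v≡w = refl
  ∑-cong (x ∷ xs) v≡w = cong₂ _+_ (v≡w x) (∑-cong xs v≡w)

  ∑-mono : ∀ (xs : List A) {v w : A → ℕ} → (∀ x → v x ≤ w x) → ∑ xs v ≤ ∑ xs w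
  ∑-mono []       v≤w = z≤n
  ∑-mono (x ∷ xs) v≤w = +-mono-≤ (v≤w x) (∑-mono xs v≤w)

  ∑-+ : ∀ (xs : List A) (v w : A → ℕ) → ∑ xs (λ x → v x + w x) ≡ ∑ xs v + ∑ xs w
  ∑-+ []       v w = refl
  ∑-+ (x ∷ xs) v w rewrite ∑-+ xs v w = interchange (v x) (w x) (∑ xs v) (∑ xs w)
    where
    interchange : ∀ a b c d → (a + b) + (c + d) ≡ (a + c) + (b + d)
    interchange = solve-∀

  ∑-*ˡ : ∀ (xs : List A) k (w : A → ℕ) → ∑ xs (λ x → k * w x) ≡ k * ∑ xs w
  ∑-*ˡ []       k w = sym (*-zeroʳ k)
  ∑-*ˡ (x ∷ xs) k w rewrite ∑-*ˡ xs k w = sym (*-distribˡ-+ k (w x) (∑ xs w))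

  ∑-const : ∀ (xs : List A) k → ∑ xs (λ _ → k) ≡ length xs * k
  ∑-const []       k = refl
  ∑-const (x ∷ xs) k = cong (k +_) (∑-const xs k)

  ∑-++ : ∀ (xs ys : List A) w → ∑ (xs ++ ys) w ≡ ∑ xs w + ∑ ys w
  ∑-++ xs ys w rewrite map-++ w xs ys = sum-++ (map w xs) (map w ys)

  ∑-map : ∀ (f : A → B) xs w → ∑ (map f xs) w ≡ ∑ xs (w ∘ f)
  ∑-map f xs w = cong sum (sym (map-∘ xs))

  -- The second factor is summed outside: for colorings it is the old word, and the inner sum then
  -- runs over the letters that extend it.
  ∑-cartesianProductWith : ∀ (f : A → B → C) xs ys w →
    ∑ (cartesianProductWith f xs ys) w ≡ ∑ ys (λ y → ∑ xs (λ x → w (f x y)))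
  ∑-cartesianProductWith f []       ys w = sym (trans (∑-const ys 0) (*-zeroʳ (length ys)))
  ∑-cartesianProductWith f (x ∷ xs) ys w = begin
    ∑ (map (f x) ys ++ cartesianProductWith f xs ys) w
      ≡⟨ ∑-++ (map (f x) ys) _ w ⟩
    ∑ (map (f x) ys) w + ∑ (cartesianProductWith f xs ys) w
      ≡⟨ cong₂ _+_ (∑-map (f x) ys w) (∑-cartesianProductWith f xs ys w) ⟩
    ∑ ys (λ y → w (f x y)) + ∑ ys (λ y → ∑ xs (λ x′ → w (f x′ y)))
      ≡⟨ ∑-+ ys _ _ ⟨
    ∑ ys (λ y → w (f x y) + ∑ xs (λ x′ → w (f x′ y))) ∎
    where open ≡-Reasoning

  ∑-filter : ∀ {P : Pred A _} (P? : Decidable P) xs w →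
    ∑ (filter P? xs) w ≡ ∑ xs (λ x → 𝟙 (P? x) * w x)
  ∑-filter P? []       w = refl
  ∑-filter P? (x ∷ xs) w with P? x
  ... | yes _ = cong₂ _+_ (sym (+-identityʳ (w x))) (∑-filter P? xs w)
  ... | no  _ = ∑-filter P? xs w

  length-filter-∑ : ∀ {P : Pred A _} (P? : Decidable P) xs →
    length (filter P? xs) ≡ ∑ xs (λ x → 𝟙 (P? x))
  length-filter-∑ P? []       = refl
  length-filter-∑ P? (x ∷ xs) with P? x
  ... | yes _ = cong suc (length-filter-∑ P? xs)
  ... | no  _ = length-filter-∑ P? xs

  -- By induction on `xs`: the occurrence of `x` is cut out of `ys`, and as `x` does not recur in
  -- `xs`, the remaining elements survive the cut.
  length-⊆ : {xs ys : List A} → Unique xs → xs ⊆ ys → length xs ≤ length ys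
  length-⊆ {xs = []}     _          _    = z≤n
  length-⊆ {xs = x ∷ xs} (x∉ ∷ uxs) x∷⊆ with ∈-∃++ (x∷⊆ (here refl))
  ... | as , bs , refl = begin
    suc (length xs)              ≤⟨ s≤s (length-⊆ uxs xs⊆) ⟩
    suc (length (as ++ bs))      ≡⟨ cong suc (length-++ as) ⟩
    suc (length as + length bs)  ≡⟨ +-suc (length as) (length bs) ⟨
    length as + suc (length bs)  ≡⟨ length-++ as ⟨
    length (as ++ x ∷ bs)        ∎
    where
    open ≤-Reasoning
    xs⊆ : xs ⊆ as ++ bs
    xs⊆ z∈ with ∈-++⁻ as (x∷⊆ (there z∈))
    ... | inj₁ z∈as         = ∈-++⁺ˡ z∈as
    ... | inj₂ (here refl)  = contradiction refl (All.lookup x∉ z∈)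
    ... | inj₂ (there z∈bs) = ∈-++⁺ʳ as z∈bs

  map-unique : (f : A → B) (xs : List A) → (∀ {x y} → x ∈ xs → y ∈ xs → f x ≡ f y → x ≡ y) →
    Unique xs → Unique (map f xs)
  map-unique f []       inj []         = []
  map-unique f (x ∷ xs) inj (x∉ ∷ uxs) =
    All.tabulate fx≢ ∷ map-unique f xs (λ p q → inj (there p) (there q)) uxs
    where
    fx≢ : ∀ {z} → z ∈ map f xs → f x ≢ z
    fx≢ z∈ fx≡z with ∈-map⁻ f z∈
    ... | y , y∈ , refl = All.lookup x∉ y∈ (inj (here refl) (there y∈) fx≡z)

  -- Injectivity is asked on members of `xs`, because the code in `unconstrained-count` is shown to
  -- be injective on the unconstrained colorings.
  length-injection : (f : A → B) (xs : List A) (ys : List B) → Unique xs →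
    (∀ {x} → x ∈ xs → f x ∈ ys) → (∀ {x y} → x ∈ xs → y ∈ xs → f x ≡ f y → x ≡ y) →
    length xs ≤ length ys
  length-injection f xs ys uxs f∈ inj = begin
    length xs         ≡⟨ length-map f xs ⟨
    length (map f xs) ≤⟨ length-⊆ (map-unique f xs inj uxs) fxs⊆ys ⟩
    length ys         ∎
    where
    open ≤-Reasoning
    fxs⊆ys : map f xs ⊆ ys
    fxs⊆ys z∈ with ∈-map⁻ f z∈
    ... | x , x∈ , refl = f∈ x∈

  length-cartesianProduct : (xs : List A) (ys : List B) →
    length (cartesianProduct xs ys) ≡ length xs * length ys
  length-cartesianProduct xs ys = begin
    length (cartesianProduct xs ys)             ≡⟨ *-identityʳ _ ⟨
    length (cartesianProduct xs ys) * 1         ≡⟨ ∑-const (cartesianProduct xs ys) 1 ⟨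
    ∑ (cartesianProduct xs ys) (λ _ → 1)        ≡⟨ ∑-cartesianProductWith _,_ xs ys (λ _ → 1) ⟩
    ∑ ys (λ _ → ∑ xs (λ _ → 1))                 ≡⟨ ∑-const ys _ ⟩
    length ys * ∑ xs (λ _ → 1)                  ≡⟨ cong (length ys *_) (trans (∑-const xs 1) (*-identityʳ _)) ⟩
    length ys * length xs                       ≡⟨ *-comm (length ys) (length xs) ⟩
    length xs * length ys                       ∎
    where open ≡-Reasoning

  ∑-allFin-const : ∀ r k → ∑ (allFin r) (λ _ → k) ≡ r * k
  ∑-allFin-const r k = trans (∑-const (allFin r) k) (cong (_* k) (length-tabulate {n = r} id))

  ∑-allFin-≟ : ∀ {r} (a : Fin r) → ∑ (allFin r) (λ k → 𝟙 (k ≟ᶠ a)) ≡ 1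
  ∑-allFin-≟ {r} a = trans (sym (length-filter-∑ (_≟ᶠ a) (allFin r))) (≤-antisym
    (length-⊆ {ys = a ∷ []} (Uniq.filter⁺ (_≟ᶠ a) (Uniq.allFin⁺ r)) λ z∈ → here (proj₂ (∈-filter⁻ (_≟ᶠ a) {xs = allFin r} z∈)))
    (length-⊆ {xs = a ∷ []} ([] ∷ []) λ { (here refl) → ∈-filter⁺ (_≟ᶠ a) (∈-allFin a) refl }))

  -- Equal colors are counted twice, so the total is 2 also for `a ≡ b`.
  ∑-allFin-pair : ∀ {r} (a b : Fin r) → ∑ (allFin r) (λ k → 𝟙 (k ≟ᶠ a) + 𝟙 (k ≟ᶠ b)) ≡ 2
  ∑-allFin-pair {r} a b = trans (∑-+ (allFin r) _ _) (cong₂ _+_ (∑-allFin-≟ a) (∑-allFin-≟ b))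

  allColorings-unique : ∀ r n → Unique (allColorings r n)
  allColorings-unique r zero    = [] ∷ []
  allColorings-unique r (suc n) =
    Uniq.cartesianProductWith⁺ Vec._∷_ ∷-injective (Uniq.allFin⁺ r) (allColorings-unique r n)

  ∈-allColorings : ∀ {r n} (v : Coloring r n) → v ∈ allColorings r n
  ∈-allColorings Vec.[]      = here refl
  ∈-allColorings (k Vec.∷ v) =
    ∈-cartesianProductWith⁺ Vec._∷_ (∈-allFin k) (∈-allColorings v)

  ∑-allColorings-suc : ∀ r n w →
    ∑ (allColorings r (suc n)) w ≡ ∑ (allColorings r n) (λ v → ∑ (allFin r) (λ k → w (k Vec.∷ v)))
  ∑-allColorings-suc r n w = ∑-cartesianProductWith Vec._∷_ (allFin r) (allColorings r n) w

open Counting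

-- Affine restrictions, forced letters and the count of unconstrained colorings

module Coloring where
  open Nat using (_+_; _*_)
  private variable
    r m n : ℕ

  -- The argument `d` is the difference less one; it lies below `n` because d ≤ y.
  is3AP⁺ : ∀ (x y z : Fin n) d → toℕ y ≡ toℕ x + suc d → toℕ z ≡ toℕ x + 2 * suc d → Is3AP x y z
  is3AP⁺ {n} x y z d y≡ z≡ = fromℕ< d<n , subst P (sym (toℕ-fromℕ< d<n)) (cong suc y≡ , cong suc z≡)
    where
    P : ℕ → Set
    P e = val y ≡ val x + suc e × val z ≡ val x + 2 * suc e
    d<n : d < n
    d<n = ≤-trans (s≤s (≤-trans (n≤1+n d) (≤-trans (m≤n+m (suc d) (toℕ x)) (≤-reflexive (sym y≡))))) (toℕ<n y)

  -- An increasing affine map sends 3-APs to 3-APs, so a rainbow 3-AP of `w` would give one of `v`.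
  -- Slope 1 serves to drop the first letter, slope 2 to restrict to a residue class modulo 2.
  rainbow3APFree-affine : ∀ (w : Coloring r m) (v : Coloring r n) (φ : Fin m → Fin n) b s →
    (∀ i → toℕ (φ i) ≡ b + suc s * toℕ i) → (∀ i → lookup w i ≡ lookup v (φ i)) →
    Rainbow3APFree v → Rainbow3APFree w
  rainbow3APFree-affine w v φ b s φ≡ w≡v free x y z (d , y≡ , z≡)
    rewrite w≡v x | w≡v y | w≡v z =
    -- The difference is multiplied by the slope `suc s`; less one, it reads
    -- `toℕ d + s * suc (toℕ d)`.
    free (φ x) (φ y) (φ z) (is3AP⁺ (φ x) (φ y) (φ z) (toℕ d + s * suc (toℕ d))
      (begin
        toℕ (φ y)                              ≡⟨ φ≡ y ⟩
        b + suc s * toℕ y                      ≡⟨ cong (λ t → b + suc s * t) (suc-injective y≡) ⟩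
        b + suc s * (toℕ x + suc (toℕ d))      ≡⟨ step b s (toℕ x) (toℕ d) ⟩
        b + suc s * toℕ x + suc (toℕ d + s * suc (toℕ d)) ≡⟨ cong (_+ _) (φ≡ x) ⟨
        toℕ (φ x) + suc (toℕ d + s * suc (toℕ d)) ∎)
      (begin
        toℕ (φ z)                              ≡⟨ φ≡ z ⟩
        b + suc s * toℕ z                      ≡⟨ cong (λ t → b + suc s * t) (suc-injective z≡) ⟩
        b + suc s * (toℕ x + 2 * suc (toℕ d))  ≡⟨ step₂ b s (toℕ x) (toℕ d) ⟩
        b + suc s * toℕ x + 2 * suc (toℕ d + s * suc (toℕ d)) ≡⟨ cong (_+ 2 * suc (toℕ d + s * suc (toℕ d))) (φ≡ x) ⟨
        toℕ (φ x) + 2 * suc (toℕ d + s * suc (toℕ d)) ∎))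
    where
    open ≡-Reasoning
    step : ∀ b s x d → b + suc s * (x + suc d) ≡ b + suc s * x + suc (d + s * suc d)
    step = solve-∀
    step₂ : ∀ b s x d → b + suc s * (x + 2 * suc d) ≡ b + suc s * x + 2 * suc (d + s * suc d)
    step₂ = solve-∀

  rainbow3APFree-tail : ∀ k (v : Coloring r n) → Rainbow3APFree (k Vec.∷ v) → Rainbow3APFree v
  rainbow3APFree-tail k v = rainbow3APFree-affine v (k Vec.∷ v) suc 1 0
    (λ i → cong suc (sym (+-identityʳ (toℕ i)))) (λ _ → refl)

  -- In a coloring extended to the left, position −(1 + j) together with the
  -- 0-indexed positions x and 1 + j + 2 x of v is a 3-AP.
  Edge : ℕ → Fin n → Fin n → Set
  Edge j x y = toℕ y ≡ suc (j + 2 * toℕ x)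

  -- The exceptional case: every edge of type `j` is monochromatic, so none of them confines the
  -- letter at position -(1 + j).
  Unconstrained : ℕ → Coloring r n → Set
  Unconstrained j v = ∀ x y → Edge j x y → lookup v x ≡ lookup v y

  unconstrained? : ∀ j (v : Coloring r n) → Dec (Unconstrained j v)
  unconstrained? j v = all? λ x → all? λ y →
    (toℕ y ≟ suc (j + 2 * toℕ x)) →-dec (lookup v x ≟ᶠ lookup v y)

  bichromatic-edge : ∀ j (v : Coloring r n) → ¬ Unconstrained j v →
    ∃[ x ] ∃[ y ] Edge j x y × lookup v x ≢ lookup v y
  bichromatic-edge j v ¬u with ¬∀⟶∃¬ _ _ (λ x → all? λ y → edge? x y →-dec (lookup v x ≟ᶠ lookup v y)) ¬u
    where
    edge? : ∀ x y → Dec (Edge j x y)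
    edge? x y = toℕ y ≟ suc (j + 2 * toℕ x)
  ... | x , ¬ux with ¬∀⟶∃¬ _ _ (λ y → (toℕ y ≟ suc (j + 2 * toℕ x)) →-dec (lookup v x ≟ᶠ lookup v y)) ¬ux
  ... | y , ¬uxy = x , y , decidable-stable (toℕ y ≟ _) (λ ¬e → ¬uxy λ e → contradiction e ¬e)
                 , λ eq → ¬uxy λ _ → eq

  -- Prepending a letter moves all positions by one: the 3-AP -(2 + j), x, y turns into -(1 + j), x
  -- + 1, y + 1.
  edge-suc : ∀ j (x y : Fin n) → Edge (suc j) x y → Edge j (suc x) (suc y)
  edge-suc j x y e = trans (cong suc e) (shift j (toℕ x))
    where
    shift : ∀ j t → 3 + (j + 2 * t) ≡ 1 + (j + 2 * (1 + t))
    shift = solve-∀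

  -- After prepending, `k` and the ends of the edge occupy positions 0, x + 1 and 2 (x + 1), a 3-AP
  -- that is rainbow if `k` differs from both colors.
  head-forced : ∀ k (v : Coloring r n) {x y} → Rainbow3APFree (k Vec.∷ v) →
    Edge 0 x y → lookup v x ≢ lookup v y → k ≡ lookup v x ⊎ k ≡ lookup v y
  head-forced k v {x} {y} free e x≢y with k ≟ᶠ lookup v x | k ≟ᶠ lookup v y
  ... | yes k≡x | _       = inj₁ k≡x
  ... | no _    | yes k≡y = inj₂ k≡y
  ... | no k≢x  | no k≢y  = contradiction (k≢x , x≢y , k≢y)
    (free zero (suc x) (suc y) (is3AP⁺ zero (suc x) (suc y) (toℕ x) refl (trans (cong suc e) (double (toℕ x)))))
    where
    double : ∀ t → 2 + 2 * t ≡ 2 * (1 + t)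
    double = solve-∀

  ∈-free⁺ : ∀ (v : Coloring r n) → Rainbow3APFree v → v ∈ rainbow3APFreeColorings r n
  ∈-free⁺ v = ∈-filter⁺ rainbow3APFree? (∈-allColorings v)

  ∈-unconstrained⁻ : ∀ j (v : Coloring r n) →
    v ∈ filter (unconstrained? j) (rainbow3APFreeColorings r n) → Rainbow3APFree v × Unconstrained j v
  ∈-unconstrained⁻ {r} {n} j v v∈ with ∈-filter⁻ (unconstrained? j) {xs = rainbow3APFreeColorings r n} v∈
  ... | v∈′ , u = proj₂ (∈-filter⁻ rainbow3APFree? {xs = allColorings r n} v∈′) , u

  unconstrained-unique : ∀ j → Unique (filter (unconstrained? j) (rainbow3APFreeColorings r n))
  unconstrained-unique j = Uniq.filter⁺ _ (Uniq.filter⁺ _ (allColorings-unique _ _))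

  even-or-odd : ∀ t → ∃[ k ] (t ≡ 2 * k ⊎ t ≡ suc (2 * k))
  even-or-odd zero    = 0 , inj₁ refl
  even-or-odd (suc t) with even-or-odd t
  ... | k , inj₁ refl = k , inj₂ refl
  ... | k , inj₂ refl = suc k , inj₁ (cong suc (sym (+-suc k (k + 0))))

  2⌊n/2⌋≤n : ∀ n → 2 * ⌊ n /2⌋ ≤ n
  2⌊n/2⌋≤n zero          = z≤n
  2⌊n/2⌋≤n (suc zero)    = z≤n
  2⌊n/2⌋≤n (suc (suc n)) = ≤-trans (≤-reflexive (*-distribˡ-+ 2 1 ⌊ n /2⌋)) (s≤s (s≤s (2⌊n/2⌋≤n n)))

  n≤1+2⌊n/2⌋ : ∀ n → n ≤ suc (2 * ⌊ n /2⌋)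
  n≤1+2⌊n/2⌋ zero          = z≤n
  n≤1+2⌊n/2⌋ (suc zero)    = s≤s z≤n
  n≤1+2⌊n/2⌋ (suc (suc n)) = ≤-trans (s≤s (s≤s (n≤1+2⌊n/2⌋ n))) (≤-reflexive (cong suc (sym (*-distribˡ-+ 2 1 ⌊ n /2⌋))))

  -- For j ≤ 2, an unconstrained coloring is determined by its entries in the residue
  -- class of offset j mod 2 and its entries at position first j and the last position.
  offset : ℕ → ℕ
  offset 1 = 1
  offset _ = 0

  first : ℕ → Fin (suc (suc n))
  first 1 = zero
  first _ = suc zero

  offset≤1 : ∀ j → offset j ≤ 1
  offset≤1 0             = z≤n
  offset≤1 1             = s≤s z≤n
  offset≤1 (suc (suc _)) = z≤n

  module _ (n : ℕ) where
    private
      N M : ℕ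
      N = suc (suc n)
      M = ⌊ N /2⌋

      φ< : ∀ j (i : Fin M) → offset j + 2 * toℕ i < N
      φ< j i = begin-strict
        offset j + 2 * toℕ i  ≤⟨ +-monoˡ-≤ (2 * toℕ i) (offset≤1 j) ⟩
        1 + 2 * toℕ i         <⟨ n<1+n _ ⟩
        2 + 2 * toℕ i         ≡⟨ *-distribˡ-+ 2 1 (toℕ i) ⟨
        2 * suc (toℕ i)       ≤⟨ *-monoʳ-≤ 2 (toℕ<n i) ⟩
        2 * M                 ≤⟨ 2⌊n/2⌋≤n N ⟩
        N                     ∎
        where open ≤-Reasoning

      φ : ℕ → Fin M → Fin N
      φ j i = fromℕ< (φ< j i)

      last : Fin N
      last = Fin.fromℕ (suc n)

      -- The entry at `x` is recorded in the half, recorded separately, or copied from the smaller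
      -- end of an edge ending at `x`.
      Covered : ℕ → Fin N → Set
      Covered j x = (∃[ i ] φ j i ≡ x) ⊎ x ≡ first j ⊎ x ≡ last ⊎ ∃[ y ] Edge j y x

      in-class : ∀ j x k → toℕ x ≡ offset j + 2 * k → Covered j x
      in-class j x k x≡ with k <? M
      ... | yes k<M = inj₁ (fromℕ< k<M , toℕ-injective (begin
        toℕ (φ j (fromℕ< k<M))           ≡⟨ toℕ-fromℕ< _ ⟩
        offset j + 2 * toℕ (fromℕ< k<M)  ≡⟨ cong (λ t → offset j + 2 * t) (toℕ-fromℕ< k<M) ⟩
        offset j + 2 * k                 ≡⟨ x≡ ⟨
        toℕ x                            ∎))
        where open ≡-Reasoning
      -- Beyond the `M` recorded entries the class contains at most the last position: here 2 M ≤ x,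
      -- while N ≤ 1 + 2 M.
      ... | no k≮M = inj₂ (inj₂ (inj₁ (toℕ-injective (trans (≤-antisym (s≤s⁻¹ (toℕ<n x)) (begin
        suc n            ≤⟨ s≤s⁻¹ (n≤1+2⌊n/2⌋ N) ⟩
        2 * M            ≤⟨ *-monoʳ-≤ 2 (≮⇒≥ k≮M) ⟩
        2 * k            ≤⟨ m≤n+m (2 * k) (offset j) ⟩
        offset j + 2 * k ≡⟨ x≡ ⟨
        toℕ x            ∎)) (sym (toℕ-fromℕ (suc n)))))))
        where open ≤-Reasoning

      out-of-class : ∀ j x k → toℕ x ≡ suc (j + 2 * k) → Covered j x
      out-of-class j x k x≡ = inj₂ (inj₂ (inj₂ (fromℕ< k<N ,
        trans x≡ (cong (λ t → suc (j + 2 * t)) (sym (toℕ-fromℕ< k<N))))))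
        where
        open ≤-Reasoning
        k<N : k < N
        k<N = begin-strict
          k               ≤⟨ m≤m+n k (k + 0) ⟩
          2 * k           ≤⟨ m≤n+m (2 * k) j ⟩
          j + 2 * k       <⟨ n<1+n _ ⟩
          suc (j + 2 * k) ≡⟨ x≡ ⟨
          toℕ x           <⟨ toℕ<n x ⟩
          N               ∎

      -- Edges of type 0 end at the odd positions, those of type 1 at the even positions from 2 on,
      -- and those of type 2 at the odd positions from 3 on. The other parity is the recorded class;
      -- what remains is position 0 for type 1 and position 1 for type 2.
      covered : ∀ {j} → j ≤ 2 → ∀ x → Covered j x
      covered {j} j≤2 x with j | j≤2 | even-or-odd (toℕ x)
      ... | 0 | _ | k     , inj₁ even = in-class 0 x k even
      ... | 0 | _ | k     , inj₂ odd  = out-of-class 0 x k odd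
      ... | 1 | _ | k     , inj₂ odd  = in-class 1 x k odd
      ... | 1 | _ | 0     , inj₁ even = inj₂ (inj₁ (toℕ-injective even))
      ... | 1 | _ | suc k , inj₁ even = out-of-class 1 x k (trans even (*-distribˡ-+ 2 1 k))
      ... | 2 | _ | k     , inj₁ even = in-class 2 x k even
      ... | 2 | _ | 0     , inj₂ odd  = inj₂ (inj₁ (toℕ-injective odd))
      ... | 2 | _ | suc k , inj₂ odd  = out-of-class 2 x k (trans odd (cong suc (*-distribˡ-+ 2 1 k)))
      ... | suc (suc (suc _)) | s≤s (s≤s ()) | _

      half : ℕ → Coloring r N → Coloring r M
      half j v = tabulate (lookup v ∘ φ j)

      -- Strong induction on the position: along an edge both colorings copy the entry of a smaller
      -- position, where they already agree.
      determined : ∀ {j} → j ≤ 2 → {v w : Coloring r N} → Unconstrained j v → Unconstrained j w →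
        lookup v (first j) ≡ lookup w (first j) → lookup v last ≡ lookup w last →
        half j v ≡ half j w → v ≡ w
      determined {r = r} {j = j} j≤2 {v} {w} uv uw first≡ last≡ half≡ = begin
        v                   ≡⟨ tabulate∘lookup v ⟨
        tabulate (lookup v) ≡⟨ tabulate-cong (λ x → <-rec P step (toℕ x) x refl) ⟩
        tabulate (lookup w) ≡⟨ tabulate∘lookup w ⟩
        w                   ∎
        where
        open ≡-Reasoning
        P : ℕ → Set
        P t = ∀ x → toℕ x ≡ t → lookup v x ≡ lookup w x
        edge-< : ∀ {x y} → Edge j y x → toℕ y < toℕ x
        edge-< {x} {y} e = ≤-trans (s≤s (≤-trans (m≤m+n (toℕ y) (toℕ y + 0)) (m≤n+m _ j))) (≤-reflexive (sym e))
        agree : ∀ x → (∀ {s} → s < toℕ x → P s) → Covered j x → lookup v x ≡ lookup w x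
        agree x rec (inj₁ (i , φi≡x)) = begin
          lookup v x           ≡⟨ cong (lookup v) φi≡x ⟨
          lookup v (φ j i)     ≡⟨ lookup∘tabulate (lookup v ∘ φ j) i ⟨
          lookup (half j v) i  ≡⟨ cong (λ u → lookup u i) half≡ ⟩
          lookup (half j w) i  ≡⟨ lookup∘tabulate (lookup w ∘ φ j) i ⟩
          lookup w (φ j i)     ≡⟨ cong (lookup w) φi≡x ⟩
          lookup w x           ∎
        agree x rec (inj₂ (inj₁ x≡)) = subst (λ z → lookup v z ≡ lookup w z) (sym x≡) first≡
        agree x rec (inj₂ (inj₂ (inj₁ x≡))) = subst (λ z → lookup v z ≡ lookup w z) (sym x≡) last≡
        agree x rec (inj₂ (inj₂ (inj₂ (y , e)))) = begin
          lookup v x ≡⟨ uv y x e ⟨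
          lookup v y ≡⟨ rec (edge-< e) y refl ⟩
          lookup w y ≡⟨ uw y x e ⟩
          lookup w x ∎
        step : ∀ t → (∀ {s} → s < t → P s) → P t
        step t rec x x≡t = agree x (subst (λ t → ∀ {s} → s < t → P s) (sym x≡t) rec) (covered j≤2 x)

      half-free : ∀ j (v : Coloring r N) → Rainbow3APFree v → Rainbow3APFree (half j v)
      half-free j v = rainbow3APFree-affine (half j v) v (φ j) (offset j) 1
        (λ i → toℕ-fromℕ< (φ< j i)) (lookup∘tabulate (lookup v ∘ φ j))

    -- The two separately recorded entries have `r` values each, and the half is again rainbow
    -- 3-AP-free, being the restriction to a residue class.
    unconstrained-count : ∀ r {j} → j ≤ 2 →
      length (filter (unconstrained? j) (rainbow3APFreeColorings r N)) ≤ r * (r * g r M)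
    unconstrained-count r {j} j≤2 = begin
      length (filter (unconstrained? j) (rainbow3APFreeColorings r N))
        ≤⟨ length-injection code _ codes (unconstrained-unique j) code∈ code-inj ⟩
      length codes                       ≡⟨ length-cartesianProduct (allFin r) _ ⟩
      length (allFin r) * (length (cartesianProduct (allFin r) (rainbow3APFreeColorings r M)))
        ≡⟨ cong₂ _*_ (length-tabulate {n = r} id) (length-cartesianProduct (allFin r) _) ⟩
      r * (length (allFin r) * g r M)    ≡⟨ cong (λ t → r * (t * g r M)) (length-tabulate {n = r} id) ⟩
      r * (r * g r M)                    ∎
      where
      open ≤-Reasoning
      code : Coloring r N → Fin r × Fin r × Coloring r M
      code v = lookup v (first j) , lookup v last , half j v
      codes : List (Fin r × Fin r × Coloring r M)
      codes = cartesianProduct (allFin r) (cartesianProduct (allFin r) (rainbow3APFreeColorings r M))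
      code∈ : ∀ {v} → v ∈ filter (unconstrained? j) (rainbow3APFreeColorings r N) → code v ∈ codes
      code∈ {v} v∈ = ∈-cartesianProduct⁺ (∈-allFin _) (∈-cartesianProduct⁺ (∈-allFin _)
        (∈-free⁺ (half j v) (half-free j v (proj₁ (∈-unconstrained⁻ j v v∈)))))
      code-inj : ∀ {v w} → v ∈ filter (unconstrained? j) (rainbow3APFreeColorings r N) →
        w ∈ filter (unconstrained? j) (rainbow3APFreeColorings r N) → code v ≡ code w → v ≡ w
      code-inj v∈ w∈ eq = determined j≤2 (proj₂ (∈-unconstrained⁻ j _ v∈)) (proj₂ (∈-unconstrained⁻ j _ w∈))
        (cong proj₁ eq) (cong (proj₁ ∘ proj₂) eq) (cong (proj₂ ∘ proj₂) eq)

open Coloring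

-- Bichromatic edges and distinct representatives of their color pairs

module Branching where
  open Nat using (_+_; _*_)
  private variable
    r n : ℕ

  ∈-usedColors⁺ : ∀ (c : Coloring r n) x → lookup c x ∈ usedColors c
  ∈-usedColors⁺ c x = ∈-filter⁺ _ (∈-allFin (lookup c x)) (x , refl)

  ∈-usedColors⁻ : ∀ (c : Coloring r n) {k} → k ∈ usedColors c → ∃[ x ] lookup c x ≡ k
  ∈-usedColors⁻ {r} c k∈ = proj₂ (∈-filter⁻ _ {xs = allFin r} k∈)

  usedColors-unique : ∀ (c : Coloring r n) → Unique (usedColors c)
  usedColors-unique {r} c = Uniq.filter⁺ _ (Uniq.allFin⁺ r)

  length-usedColors-≤ : ∀ (c : Coloring r n) ks → (∀ x → lookup c x ∈ ks) →
    length (usedColors c) ≤ length ks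
  length-usedColors-≤ c ks ∈ks = length-⊆ (usedColors-unique c) used⊆
    where
    used⊆ : usedColors c ⊆ ks
    used⊆ k∈ with ∈-usedColors⁻ c k∈
    ... | x , refl = ∈ks x

  twoColoring-pair : ∀ (c : Coloring r n) {α β} → (∀ x → lookup c x ≡ α ⊎ lookup c x ≡ β) → TwoColoring c
  twoColoring-pair c {α} {β} h = length-usedColors-≤ c (α ∷ β ∷ []) λ x →
    [ here , there ∘ here ]′ (h x)

  twoColoring-∷ : ∀ k (v : Coloring r n) x → k ≡ lookup v x → TwoColoring v → TwoColoring (k Vec.∷ v)
  twoColoring-∷ k v x k≡ two = ≤-trans (length-usedColors-≤ (k Vec.∷ v) (usedColors v) λ where
    zero    → subst (_∈ usedColors v) (sym k≡) (∈-usedColors⁺ v x)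
    (suc y) → ∈-usedColors⁺ v y) two

  twoColoring⇒free : ∀ (c : Coloring r n) → TwoColoring c → Rainbow3APFree c
  twoColoring⇒free c two x y z _ (x≢y , y≢z , x≢z) = contradiction
    (≤-trans (length-⊆ ((x≢y ∷ x≢z ∷ []) ∷ (y≢z ∷ []) ∷ [] ∷ []) xyz⊆) two) λ { (s≤s (s≤s ())) }
    where
    xyz⊆ : lookup c x ∷ lookup c y ∷ lookup c z ∷ [] ⊆ usedColors c
    xyz⊆ (here refl)                 = ∈-usedColors⁺ c x
    xyz⊆ (there (here refl))         = ∈-usedColors⁺ c y
    xyz⊆ (there (there (here refl))) = ∈-usedColors⁺ c z

  -- The edge may carry its two colors in either order, so that either of them can be singled out as
  -- a representative.
  Bichromatic : ∀ j (v : Coloring r n) (α β : Fin r) → Set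
  Bichromatic j v α β = α ≢ β × ∃[ x ] ∃[ y ] Edge j x y ×
    ((lookup v x ≡ α × lookup v y ≡ β) ⊎ (lookup v x ≡ β × lookup v y ≡ α))

  bichromatic-sym : ∀ j (v : Coloring r n) {α β} → Bichromatic j v α β → Bichromatic j v β α
  bichromatic-sym j v (α≢β , x , y , e , eqs) = (α≢β ∘ sym) , x , y , e , Sum.swap eqs

  bichromatic-∷ : ∀ j k (v : Coloring r n) {α β} → Bichromatic (suc j) v α β → Bichromatic j (k Vec.∷ v) α β
  bichromatic-∷ j k v (α≢β , x , y , e , eqs) = α≢β , suc x , suc y , edge-suc j x y e , eqs

  constrained⇒bichromatic : ∀ j (v : Coloring r n) → ¬ Unconstrained j v → ∃[ α ] ∃[ β ] Bichromatic j v α β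
  constrained⇒bichromatic j v ¬u with bichromatic-edge j v ¬u
  ... | x , y , e , x≢y = _ , _ , x≢y , x , y , e , inj₁ (refl , refl)

  bichromatic-forced : ∀ k (v : Coloring r n) {α β} → Rainbow3APFree (k Vec.∷ v) → Bichromatic 0 v α β →
    k ≡ α ⊎ k ≡ β
  bichromatic-forced k v free (α≢β , x , y , e , inj₁ (refl , refl)) = head-forced k v free e α≢β
  bichromatic-forced k v free (α≢β , x , y , e , inj₂ (refl , refl)) = Sum.swap (head-forced k v free e (α≢β ∘ sym))

  -- Every position is reached from position 0 along edges of type 0 and 1 (the binary
  -- heap), so a set of colors that no such edge leaves contains all colors or none.
  heap-closed : ∀ {Q : Fin (suc n) → Set} →
    (∀ j → j ≤ 1 → ∀ x y → Edge j x y → (Q x → Q y) × (Q y → Q x)) → ∀ x y → Q x → Q y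
  heap-closed {n} {Q} closed x y Qx = proj₂ (root y) (proj₁ (root x) Qx)
    where
    Root : ℕ → Set
    Root t = ∀ x → toℕ x ≡ t → (Q x → Q zero) × (Q zero → Q x)
    via : ∀ x t → (∀ {s} → s < t → Root s) → toℕ x ≡ t → ∀ j k → j ≤ 1 → toℕ x ≡ suc (j + 2 * k) →
      (Q x → Q zero) × (Q zero → Q x)
    via x t rec x≡t j k j≤1 x≡ = (proj₁ up ∘ proj₂ link) , (proj₁ link ∘ proj₂ up)
      where
      k<x : k < toℕ x
      k<x = ≤-trans (s≤s (≤-trans (m≤m+n k (k + 0)) (m≤n+m _ j))) (≤-reflexive (sym x≡))
      k<n : k < suc n
      k<n = <-trans k<x (toℕ<n x)
      link : (Q (fromℕ< k<n) → Q x) × (Q x → Q (fromℕ< k<n))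
      link = closed j j≤1 (fromℕ< k<n) x (trans x≡ (cong (λ s → suc (j + 2 * s)) (sym (toℕ-fromℕ< k<n))))
      up : (Q (fromℕ< k<n) → Q zero) × (Q zero → Q (fromℕ< k<n))
      up = rec (subst (k <_) x≡t k<x) (fromℕ< k<n) (toℕ-fromℕ< k<n)
    step : ∀ t → (∀ {s} → s < t → Root s) → Root t
    step t rec zero    x≡t = id , id
    step t rec (suc x) x≡t with even-or-odd (toℕ x)
    ... | k , inj₁ even = via (suc x) t rec x≡t 0 k z≤n (cong suc even)
    ... | k , inj₂ odd  = via (suc x) t rec x≡t 1 k ≤-refl (cong suc odd)
    root : ∀ x → (Q x → Q zero) × (Q zero → Q x)
    root x = <-rec Root step (toℕ x) x refl

  -- A pair of type `i` is not contained in a pair of type `j`, and `α` is the color that witnesses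
  -- this.
  Differ : ∀ i j (v : Coloring r n) → Set
  Differ i j v = ∃[ α ] ∃[ β ] ∃[ γ ] ∃[ δ ]
    Bichromatic i v α β × Bichromatic j v γ δ × α ≢ γ × α ≢ δ

  module _ (v : Coloring r n) (γ δ : Fin r) where
    Within : Fin n → Set
    Within x = lookup v x ≡ γ ⊎ lookup v x ≡ δ

    within? : ∀ x → Dec (Within x)
    within? x = (lookup v x ≟ᶠ γ) ⊎-dec (lookup v x ≟ᶠ δ)

    Closed : ℕ → Fin n → Fin n → Set
    Closed j x y = Edge j x y → (Within x → Within y) × (Within y → Within x)

    closed? : ∀ j x y → Dec (Closed j x y)
    closed? j x y = (toℕ y ≟ _) →-dec ((within? x →-dec within? y) ×-dec (within? y →-dec within? x))

    Leaving : ℕ → Set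
    Leaving j = ∃[ α ] ∃[ β ] Bichromatic j v α β × α ≢ γ × α ≢ δ

    -- An edge that violates closedness has exactly one end colored from {γ, δ}; it is therefore
    -- bichromatic, and its other end supplies the color outside.
    closed-or-leaving : ∀ j → (∀ x y → Closed j x y) ⊎ Leaving j
    closed-or-leaving j with all? (λ x → all? (closed? j x))
    ... | yes cl = inj₁ cl
    ... | no ¬cl with ¬∀⟶∃¬ _ _ (λ x → all? (closed? j x)) ¬cl
    ...   | x , ¬clx with ¬∀⟶∃¬ _ _ (closed? j x) ¬clx
    ...     | y , ¬clxy with toℕ y ≟ suc (j + 2 * toℕ x) | within? x | within? y
    ...       | no ¬e | _      | _      = contradiction (λ e → contradiction e ¬e) ¬clxy
    ...       | yes e | yes px | yes py = contradiction (λ _ → (λ _ → py) , (λ _ → px)) ¬clxy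
    ...       | yes e | no ¬px | no ¬py = contradiction (λ _ → (λ px → contradiction px ¬px) , (λ py → contradiction py ¬py)) ¬clxy
    ...       | yes e | no ¬px | yes py = inj₂ (lookup v x , lookup v y ,
      ((λ eq → ¬px (subst (λ k → k ≡ γ ⊎ k ≡ δ) (sym eq) py)) , x , y , e , inj₁ (refl , refl)) , ¬px ∘ inj₁ , ¬px ∘ inj₂)
    ...       | yes e | yes px | no ¬py = inj₂ (lookup v y , lookup v x ,
      ((λ eq → ¬py (subst (λ k → k ≡ γ ⊎ k ≡ δ) (sym eq) px)) , x , y , e , inj₂ (refl , refl)) , ¬py ∘ inj₁ , ¬py ∘ inj₂)

  -- Let {γ, δ} come from an edge of type 1 and {ε, ζ} from one of type 0. If no edge of either type
  -- leaves {γ, δ}, the heap connectivity leaves only these two colors. The pair of a leaving edge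
  -- of type 0 differs from {γ, δ} at once. If an edge of type 1 leaves with color α, either α lies
  -- in {ε, ζ}, and this pair differs from {γ, δ}, or the pair of the leaving edge differs from {ε,
  -- ζ}.
  edge-pairs-differ : ∀ (v : Coloring r (suc n)) → ¬ TwoColoring v → ¬ Unconstrained 0 v → ¬ Unconstrained 1 v →
    Differ 0 1 v ⊎ Differ 1 0 v
  edge-pairs-differ {r = r} v ¬two ¬u₀ ¬u₁ =
    result (constrained⇒bichromatic 0 v ¬u₀) (constrained⇒bichromatic 1 v ¬u₁)
    where
    module _ {ε ζ γ δ : Fin r} (bi₀ : Bichromatic 0 v ε ζ) (bi₁ : Bichromatic 1 v γ δ) where
      leaving₁ : Leaving v γ δ 1 → Differ 0 1 v ⊎ Differ 1 0 v
      leaving₁ (α , β , bi , α≢γ , α≢δ) with α ≟ᶠ ε | α ≟ᶠ ζ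
      ... | yes α≡ε | _       = inj₁ (ε , ζ , γ , δ , bi₀ , bi₁ , subst (_≢ γ) α≡ε α≢γ , subst (_≢ δ) α≡ε α≢δ)
      ... | no _    | yes α≡ζ = inj₁ (ζ , ε , γ , δ , bichromatic-sym 0 v bi₀ , bi₁ , subst (_≢ γ) α≡ζ α≢γ , subst (_≢ δ) α≡ζ α≢δ)
      ... | no α≢ε  | no α≢ζ  = inj₂ (α , β , ε , ζ , bi , bi₀ , α≢ε , α≢ζ)

      two-colored : (∀ x y → Closed v γ δ 0 x y) → (∀ x y → Closed v γ δ 1 x y) → TwoColoring v
      two-colored cl₀ cl₁ = twoColoring-pair v λ y → heap-closed closed x y
        ([ inj₁ ∘ proj₁ , inj₂ ∘ proj₁ ]′ (proj₂ (proj₂ (proj₂ (proj₂ bi₁)))))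
        where
        x = proj₁ (proj₂ bi₁)
        closed : ∀ j → j ≤ 1 → ∀ x y → Closed v γ δ j x y
        closed 0 _ = cl₀
        closed 1 _ = cl₁
        closed (suc (suc _)) (s≤s ())

      cases : (∀ x y → Closed v γ δ 0 x y) ⊎ Leaving v γ δ 0 → (∀ x y → Closed v γ δ 1 x y) ⊎ Leaving v γ δ 1 →
        Differ 0 1 v ⊎ Differ 1 0 v
      cases (inj₂ (α , β , bi , α≢γ , α≢δ)) _ = inj₁ (α , β , γ , δ , bi , bi₁ , α≢γ , α≢δ)
      cases (inj₁ _)   (inj₂ l)   = leaving₁ l
      cases (inj₁ cl₀) (inj₁ cl₁) = contradiction (two-colored cl₀ cl₁) ¬two

    result : ∃[ ε ] ∃[ ζ ] Bichromatic 0 v ε ζ → ∃[ γ ] ∃[ δ ] Bichromatic 1 v γ δ → Differ 0 1 v ⊎ Differ 1 0 v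
    result (_ , _ , bi₀) (γ , δ , bi₁) =
      cases bi₀ bi₁ (closed-or-leaving v γ δ 0) (closed-or-leaving v γ δ 1)

  -- The colors `α`, `γ`, `ε` represent the three pairs; the primed colors are the second members.
  Representatives : ∀ i j k → Coloring r n → Set
  Representatives i j k v = ∃[ α ] ∃[ α′ ] ∃[ γ ] ∃[ γ′ ] ∃[ ε ] ∃[ ε′ ]
    Bichromatic i v α α′ × Bichromatic j v γ γ′ × Bichromatic k v ε ε′ × α ≢ γ × γ ≢ ε × α ≢ ε

  -- The order of the choices matters. As `α` avoids the whole pair of type `j`, a color other than
  -- `α` is picked first from the pair of type `k`, then a color other than that one from the pair
  -- of type `j`.
  distinct-representatives : ∀ i j k (v : Coloring r n) → Differ i j v → ∃[ ε ] ∃[ ζ ] Bichromatic k v ε ζ →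
    Representatives i j k v
  distinct-representatives i j k v (α , β , γ , δ , biᵢ , biⱼ , α≢γ , α≢δ) (ε , ζ , biₖ) =
    pick (avoid k biₖ α)
    where
    avoid : ∀ k {α β} → Bichromatic k v α β → ∀ κ → (α ≢ κ × Bichromatic k v α β) ⊎ (β ≢ κ × Bichromatic k v β α)
    avoid k {α} bi@(α≢β , _) κ with α ≟ᶠ κ
    ... | no α≢κ   = inj₁ (α≢κ , bi)
    ... | yes refl = inj₂ (α≢β ∘ sym , bichromatic-sym k v bi)
    pick₂ : ∀ ε ε′ → Bichromatic k v ε ε′ → ε ≢ α → Representatives i j k v
    pick₂ ε ε′ bi ε≢α with avoid j biⱼ ε
    ... | inj₁ (γ≢ε , bi′) = α , β , γ , δ , ε , ε′ , biᵢ , bi′ , bi , α≢γ , γ≢ε , ε≢α ∘ sym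
    ... | inj₂ (δ≢ε , bi′) = α , β , δ , γ , ε , ε′ , biᵢ , bi′ , bi , α≢δ , δ≢ε , ε≢α ∘ sym
    pick : (ε ≢ α × Bichromatic k v ε ζ) ⊎ (ζ ≢ α × Bichromatic k v ζ ε) → Representatives i j k v
    pick (inj₁ (ε≢α , bi)) = pick₂ ε ζ bi ε≢α
    pick (inj₂ (ζ≢α , bi)) = pick₂ ζ ε bi ζ≢α

  transversal : ∀ (v : Coloring r (suc n)) → ¬ TwoColoring v →
    ¬ Unconstrained 0 v → ¬ Unconstrained 1 v → ¬ Unconstrained 2 v → Representatives 0 1 2 v
  transversal {r = r} v ¬two ¬u₀ ¬u₁ ¬u₂ = cases (edge-pairs-differ v ¬two ¬u₀ ¬u₁)
    where
    bi₂ : ∃[ ε ] ∃[ ζ ] Bichromatic 2 v ε ζ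
    bi₂ = constrained⇒bichromatic 2 v ¬u₂
    swap₀₁ : Representatives 1 0 2 v → Representatives 0 1 2 v
    swap₀₁ (γ , γ′ , α , α′ , ε , ε′ , biγ , biα , biε , γ≢α , α≢ε , γ≢ε) =
      α , α′ , γ , γ′ , ε , ε′ , biα , biγ , biε , γ≢α ∘ sym , γ≢ε , α≢ε
    cases : Differ 0 1 v ⊎ Differ 1 0 v → Representatives 0 1 2 v
    cases (inj₁ d) = distinct-representatives 0 1 2 v d bi₂
    cases (inj₂ d) = swap₀₁ (distinct-representatives 1 0 2 v d bi₂)

open Branching

-- Recurrences from prepending one letter and three letters

module Recurrence where
  open Nat using (_+_; _*_)
  private variable
    r n : ℕ

  unconstrained : ℕ → ℕ → ℕ → ℕ
  unconstrained j r n = length (filter (unconstrained? j) (rainbow3APFreeColorings r n))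

  length-filter-free : ∀ r n {P : Pred (Coloring r n) _} (P? : Decidable P) →
    length (filter P? (rainbow3APFreeColorings r n)) ≡
    ∑ (allColorings r n) (λ v → 𝟙 (rainbow3APFree? v) * 𝟙 (P? v))
  length-filter-free r n P? = trans (length-filter-∑ P? (rainbow3APFreeColorings r n))
    (∑-filter rainbow3APFree? (allColorings r n) _)

  ∑-allFin-bound : ∀ r {w : Fin r → ℕ} b → (∀ k → w k ≤ b) → ∑ (allFin r) w ≤ r * b
  ∑-allFin-bound r b w≤b = ≤-trans (∑-mono (allFin r) w≤b) (≤-reflexive (∑-allFin-const r b))

  𝟙-mono : {P Q : Set} (p : Dec P) (q : Dec Q) → (P → Q) → 𝟙 p ≤ 𝟙 q
  𝟙-mono (yes p) q f = ≤-reflexive (sym (𝟙-yes q (f p)))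
  𝟙-mono (no _)  q f = z≤n

  𝟙-pair : ∀ {P : Set} (p : Dec P) (k a b : Fin r) → (P → k ≡ a ⊎ k ≡ b) → 𝟙 p ≤ 𝟙 (k ≟ᶠ a) + 𝟙 (k ≟ᶠ b)
  𝟙-pair (no _)  k a b f = z≤n
  𝟙-pair (yes p) k a b f with f p
  ... | inj₁ k≡a = ≤-trans (≤-reflexive (sym (𝟙-yes (k ≟ᶠ a) k≡a))) (m≤m+n _ _)
  ... | inj₂ k≡b = ≤-trans (≤-reflexive (sym (𝟙-yes (k ≟ᶠ b) k≡b))) (m≤n+m _ _)

  extensions : Coloring r n → ℕ
  extensions {r} v = ∑ (allFin r) (λ k → 𝟙 (rainbow3APFree? (k Vec.∷ v)))

  -- Freeness passes to tails, so a word that is not free contributes nothing. A bichromatic edge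
  -- leaves a free word at most two extensions; an unconstrained one has at most `r`.
  extensions-bound : ∀ (v : Coloring r n) →
    extensions v ≤ 2 * 𝟙 (rainbow3APFree? v) + r * (𝟙 (rainbow3APFree? v) * 𝟙 (unconstrained? 0 v))
  extensions-bound {r} v = bound (rainbow3APFree? v) (unconstrained? 0 v)
    where
    bound : (f : Dec (Rainbow3APFree v)) (u : Dec (Unconstrained 0 v)) →
      extensions v ≤ 2 * 𝟙 f + r * (𝟙 f * 𝟙 u)
    bound (no ¬f) _ = ≤-trans (∑-allFin-bound r 0 λ k →
      ≤-reflexive (𝟙-no (rainbow3APFree? (k Vec.∷ v)) (¬f ∘ rainbow3APFree-tail k v))) ≤-refl
    bound (yes _) (yes _) = ≤-trans (∑-allFin-bound r 1 λ k → 𝟙≤1 (rainbow3APFree? (k Vec.∷ v))) (m≤n+m (r * 1) 2)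
    bound (yes _) (no ¬u) = ≤-trans (pair (constrained⇒bichromatic 0 v ¬u)) (m≤m+n 2 (r * 0))
      where
      pair : ∃[ α ] ∃[ β ] Bichromatic 0 v α β → extensions v ≤ 2
      pair (α , β , bi) = ≤-trans
        (∑-mono (allFin r) λ k → 𝟙-pair (rainbow3APFree? (k Vec.∷ v)) k α β (λ f → bichromatic-forced k v f bi))
        (≤-reflexive (∑-allFin-pair α β))

  g-suc : ∀ r n → g r (suc n) ≤ 2 * g r n + r * unconstrained 0 r n
  g-suc r n = begin
    g r (suc n)
      ≡⟨ length-filter-∑ rainbow3APFree? (allColorings r (suc n)) ⟩
    ∑ (allColorings r (suc n)) (λ v → 𝟙 (rainbow3APFree? v))
      ≡⟨ ∑-allColorings-suc r n _ ⟩
    ∑ (allColorings r n) extensions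
      ≤⟨ ∑-mono (allColorings r n) extensions-bound ⟩
    ∑ (allColorings r n) (λ v → 2 * free v + r * (free v * 𝟙 (unconstrained? 0 v)))
      ≡⟨ ∑-+ (allColorings r n) _ _ ⟩
    ∑ (allColorings r n) (λ v → 2 * free v) + ∑ (allColorings r n) (λ v → r * (free v * 𝟙 (unconstrained? 0 v)))
      ≡⟨ cong₂ _+_ (∑-*ˡ (allColorings r n) 2 _) (∑-*ˡ (allColorings r n) r _) ⟩
    2 * ∑ (allColorings r n) free + r * ∑ (allColorings r n) (λ v → free v * 𝟙 (unconstrained? 0 v))
      ≡⟨ cong₂ (λ s t → 2 * s + r * t) (length-filter-∑ rainbow3APFree? (allColorings r n)) (length-filter-free r n (unconstrained? 0)) ⟨
    2 * g r n + r * unconstrained 0 r n ∎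
    where
    open ≤-Reasoning
    free : Coloring r n → ℕ
    free v = 𝟙 (rainbow3APFree? v)

  multicolored : Coloring r n → ℕ
  multicolored v = 𝟙 (rainbow3APFree? v) * 𝟙 (¬? (twoColoring? v))

  multicolored⁻ : ∀ (v : Coloring r n) {b} → (Rainbow3APFree v → ¬ TwoColoring v → 1 ≤ b) → multicolored v ≤ b
  multicolored⁻ v h with rainbow3APFree? v | twoColoring? v
  ... | yes f | no ¬two = h f ¬two
  ... | yes _ | yes _   = z≤n
  ... | no _  | _       = z≤n

  ∑³ : ∀ r → (Fin r → Fin r → Fin r → ℕ) → ℕ
  ∑³ r w = ∑ (allFin r) λ a → ∑ (allFin r) λ b → ∑ (allFin r) λ c → w a b c

  ∑³-mono : ∀ r {v w : Fin r → Fin r → Fin r → ℕ} → (∀ a b c → v a b c ≤ w a b c) → ∑³ r v ≤ ∑³ r w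
  ∑³-mono r v≤w = ∑-mono (allFin r) λ a → ∑-mono (allFin r) λ b → ∑-mono (allFin r) λ c → v≤w a b c

  ∑³-bound : ∀ r {w : Fin r → Fin r → Fin r → ℕ} b → (∀ x y z → w x y z ≤ b) → ∑³ r w ≤ r * (r * (r * b))
  ∑³-bound r b w≤b = ∑-allFin-bound r _ λ x → ∑-allFin-bound r _ λ y → ∑-allFin-bound r b (w≤b x y)

  ∑³-+ : ∀ r (v w : Fin r → Fin r → Fin r → ℕ) → ∑³ r (λ a b c → v a b c + w a b c) ≡ ∑³ r v + ∑³ r w
  ∑³-+ r v w = trans (∑-cong (allFin r) λ a → trans (∑-cong (allFin r) λ b → ∑-+ (allFin r) _ _) (∑-+ (allFin r) _ _))
    (∑-+ (allFin r) _ _)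

  ∑³-product : ∀ r (u v w : Fin r → ℕ) →
    ∑³ r (λ a b c → u a * (v b * w c)) ≡ ∑ (allFin r) u * (∑ (allFin r) v * ∑ (allFin r) w)
  ∑³-product r u v w = begin
    ∑³ r (λ a b c → u a * (v b * w c))
      ≡⟨ ∑-cong (allFin r) (λ a → ∑-cong (allFin r) λ b →
           trans (∑-*ˡ (allFin r) (u a) _) (cong (u a *_) (∑-*ˡ (allFin r) (v b) w))) ⟩
    ∑ (allFin r) (λ a → ∑ (allFin r) λ b → u a * (v b * W))
      ≡⟨ ∑-cong (allFin r) (λ a → trans (∑-*ˡ (allFin r) (u a) _) (cong (u a *_) (∑-*ʳ v W))) ⟩
    ∑ (allFin r) (λ a → u a * (∑ (allFin r) v * W))
      ≡⟨ ∑-*ʳ u (∑ (allFin r) v * W) ⟩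
    ∑ (allFin r) u * (∑ (allFin r) v * W) ∎
    where
    open ≡-Reasoning
    W : ℕ
    W = ∑ (allFin r) w
    ∑-*ʳ : ∀ t k → ∑ (allFin r) (λ b → t b * k) ≡ ∑ (allFin r) t * k
    ∑-*ʳ t k = trans (∑-cong (allFin r) λ b → *-comm (t b) k) (trans (∑-*ˡ (allFin r) k t) (*-comm k _))

  -- The letters `c`, `b`, `a` are prepended in this order, to positions -1, -2, -3 relative to `v`,
  -- and are constrained by the edges of type 0, 1, 2.
  extensions³ : Coloring r n → ℕ
  extensions³ {r} v = ∑³ r λ c b a → multicolored (a Vec.∷ b Vec.∷ c Vec.∷ v)

  consecutive-free : ∀ a b c (v : Coloring r n) → Rainbow3APFree (a Vec.∷ b Vec.∷ c Vec.∷ v) →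
    ¬ (a ≢ b × b ≢ c × a ≢ c)
  consecutive-free a b c v free = free zero (suc zero) (suc (suc zero)) (is3AP⁺ zero (suc zero) (suc (suc zero)) 0 refl refl)

  module _ (v : Coloring r n) {a b c : Fin r} (free : Rainbow3APFree (a Vec.∷ b Vec.∷ c Vec.∷ v)) where
    private
      free₁ : Rainbow3APFree (b Vec.∷ c Vec.∷ v)
      free₁ = rainbow3APFree-tail a (b Vec.∷ c Vec.∷ v) free
      free₀ : Rainbow3APFree (c Vec.∷ v)
      free₀ = rainbow3APFree-tail b (c Vec.∷ v) free₁

    forced₀ : ∀ {α β} → Bichromatic 0 v α β → c ≡ α ⊎ c ≡ β
    forced₀ = bichromatic-forced c v free₀

    forced₁ : ∀ {α β} → Bichromatic 1 v α β → b ≡ α ⊎ b ≡ β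
    forced₁ bi = bichromatic-forced b (c Vec.∷ v) free₁ (bichromatic-∷ 0 c v bi)

    forced₂ : ∀ {α β} → Bichromatic 2 v α β → a ≡ α ⊎ a ≡ β
    forced₂ bi = bichromatic-forced a (b Vec.∷ c Vec.∷ v) free
      (bichromatic-∷ 0 b (c Vec.∷ v) (bichromatic-∷ 1 c v bi))

  bichromatic-used : ∀ j (v : Coloring r n) {α β k} → Bichromatic j v α β → k ≡ α ⊎ k ≡ β → ∃[ x ] k ≡ lookup v x
  bichromatic-used j v (_ , x , y , _ , inj₁ (x≡ , y≡)) (inj₁ k≡) = x , trans k≡ (sym x≡)
  bichromatic-used j v (_ , x , y , _ , inj₁ (x≡ , y≡)) (inj₂ k≡) = y , trans k≡ (sym y≡)
  bichromatic-used j v (_ , x , y , _ , inj₂ (x≡ , y≡)) (inj₁ k≡) = y , trans k≡ (sym y≡)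
  bichromatic-used j v (_ , x , y , _ , inj₂ (x≡ , y≡)) (inj₂ k≡) = x , trans k≡ (sym x≡)

  -- Each new letter is confined to colors occurring in `v`, so every free extension stays 2-colored
  -- and has weight 0.
  extensions³-two : ∀ (v : Coloring r n) → TwoColoring v →
    ∃[ α ] ∃[ β ] Bichromatic 0 v α β → ∃[ α ] ∃[ β ] Bichromatic 1 v α β → ∃[ α ] ∃[ β ] Bichromatic 2 v α β →
    extensions³ v ≤ 0
  extensions³-two {r} v two (_ , _ , bi₀) (_ , _ , bi₁) (_ , _ , bi₂) = ≤-trans
    (∑³-bound r 0 λ c b a → multicolored⁻ (a Vec.∷ b Vec.∷ c Vec.∷ v) λ free ¬two → contradiction (still-two free) ¬two)
    (≤-reflexive (trans (cong (λ t → r * (r * t)) (*-zeroʳ r)) (trans (cong (r *_) (*-zeroʳ r)) (*-zeroʳ r))))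
    where
    still-two : ∀ {a b c} → Rainbow3APFree (a Vec.∷ b Vec.∷ c Vec.∷ v) → TwoColoring (a Vec.∷ b Vec.∷ c Vec.∷ v)
    still-two {a} {b} {c} free =
      let x , c≡ = bichromatic-used 0 v bi₀ (forced₀ v free bi₀)
          y , b≡ = bichromatic-used 1 v bi₁ (forced₁ v free bi₁)
          z , a≡ = bichromatic-used 2 v bi₂ (forced₂ v free bi₂)
      in twoColoring-∷ a (b Vec.∷ c Vec.∷ v) (suc (suc z)) a≡
           (twoColoring-∷ b (c Vec.∷ v) (suc y) b≡ (twoColoring-∷ c v x c≡ two))

  -- Of the eight words in the product of the three pairs, the one formed by the three
  -- distinct colors is rainbow.
  extensions³-transversal : ∀ (v : Coloring r n) → Representatives 0 1 2 v → extensions³ v ≤ 7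
  extensions³-transversal {r} v (α₀ , β₀ , α₁ , β₁ , α₂ , β₂ , bi₀ , bi₁ , bi₂ , α₀≢α₁ , α₁≢α₂ , α₀≢α₂) =
    +-cancelʳ-≤ 1 _ 7 (begin
      extensions³ v + 1
        ≡⟨ cong (extensions³ v +_) (trans (∑³-product r (is α₀) (is α₁) (is α₂))
             (cong₂ _*_ (∑-allFin-≟ α₀) (cong₂ _*_ (∑-allFin-≟ α₁) (∑-allFin-≟ α₂)))) ⟨
      extensions³ v + ∑³ r excluded
        ≡⟨ ∑³-+ r (λ c b a → multicolored (a Vec.∷ b Vec.∷ c Vec.∷ v)) excluded ⟨
      ∑³ r (λ c b a → multicolored (a Vec.∷ b Vec.∷ c Vec.∷ v) + excluded c b a)
        ≤⟨ ∑³-mono r pointwise ⟩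
      ∑³ r (λ c b a → pair α₀ β₀ c * (pair α₁ β₁ b * pair α₂ β₂ a))
        ≡⟨ trans (∑³-product r (pair α₀ β₀) (pair α₁ β₁) (pair α₂ β₂)) (cong₂ _*_ (∑-allFin-pair α₀ β₀) (cong₂ _*_ (∑-allFin-pair α₁ β₁) (∑-allFin-pair α₂ β₂))) ⟩
      8 ∎)
    where
    open ≤-Reasoning
    is : Fin r → Fin r → ℕ
    is α k = 𝟙 (k ≟ᶠ α)
    pair : Fin r → Fin r → Fin r → ℕ
    pair α β k = is α k + is β k
    pair-≥1 : ∀ α β {k} → k ≡ α ⊎ k ≡ β → 1 ≤ pair α β k
    pair-≥1 α β {k} k∈ = 𝟙-pair (yes k∈) k α β id
    excluded : Fin r → Fin r → Fin r → ℕ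
    excluded c b a = is α₀ c * (is α₁ b * is α₂ a)
    excluded-0 : ∀ {a b c} → Rainbow3APFree (a Vec.∷ b Vec.∷ c Vec.∷ v) → excluded c b a ≤ 0
    excluded-0 {a} {b} {c} free with c ≟ᶠ α₀ | b ≟ᶠ α₁ | a ≟ᶠ α₂
    ... | no _   | _      | _      = z≤n
    ... | yes _  | no _   | _      = z≤n
    ... | yes _  | yes _  | no _   = z≤n
    ... | yes c≡ | yes b≡ | yes a≡ = contradiction
      ( (λ a≡b → α₁≢α₂ (trans (sym b≡) (trans (sym a≡b) a≡)))
      , (λ b≡c → α₀≢α₁ (trans (sym c≡) (trans (sym b≡c) b≡)))
      , (λ a≡c → α₀≢α₂ (trans (sym c≡) (trans (sym a≡c) a≡))))
      (consecutive-free a b c v free)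
    excluded≤ : ∀ c b a → excluded c b a ≤ pair α₀ β₀ c * (pair α₁ β₁ b * pair α₂ β₂ a)
    excluded≤ c b a = *-mono-≤ (m≤m+n (is α₀ c) _) (*-mono-≤ (m≤m+n (is α₁ b) _) (m≤m+n (is α₂ a) _))
    pointwise : ∀ c b a → multicolored (a Vec.∷ b Vec.∷ c Vec.∷ v) + excluded c b a ≤
      pair α₀ β₀ c * (pair α₁ β₁ b * pair α₂ β₂ a)
    pointwise c b a = by-freeness (rainbow3APFree? (a Vec.∷ b Vec.∷ c Vec.∷ v))
      where
      by-freeness : Dec (Rainbow3APFree (a Vec.∷ b Vec.∷ c Vec.∷ v)) → multicolored (a Vec.∷ b Vec.∷ c Vec.∷ v) + excluded c b a ≤
        pair α₀ β₀ c * (pair α₁ β₁ b * pair α₂ β₂ a)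
      by-freeness (no ¬free) = ≤-trans (+-monoˡ-≤ (excluded c b a)
        (multicolored⁻ (a Vec.∷ b Vec.∷ c Vec.∷ v) {0} λ free _ → contradiction free ¬free)) (excluded≤ c b a)
      by-freeness (yes free) = ≤-trans (+-mono-≤ (multicolored⁻ (a Vec.∷ b Vec.∷ c Vec.∷ v) {1} λ _ _ → ≤-refl) (excluded-0 free))
        (*-mono-≤ (pair-≥1 α₀ β₀ (forced₀ v free bi₀))
          (*-mono-≤ (pair-≥1 α₁ β₁ (forced₁ v free bi₁)) (pair-≥1 α₂ β₂ (forced₂ v free bi₂))))

  -- If all three types are constrained, a 2-coloring contributes nothing and any other free word at
  -- most 7. The exceptional words get the trivial bound r³, paid by any one of the last three
  -- indicators.
  extensions³-bound : ∀ (v : Coloring r (suc n)) → extensions³ v ≤ 7 * multicolored v +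
    r * (r * r) * (𝟙 (rainbow3APFree? v) * 𝟙 (unconstrained? 0 v) +
      (𝟙 (rainbow3APFree? v) * 𝟙 (unconstrained? 1 v) + 𝟙 (rainbow3APFree? v) * 𝟙 (unconstrained? 2 v)))
  extensions³-bound {r} v = bound (rainbow3APFree? v) (twoColoring? v) (unconstrained? 0 v) (unconstrained? 1 v) (unconstrained? 2 v)
    where
    R = r * (r * r)
    ≤R : ∀ {s} t → 1 ≤ t → extensions³ v ≤ s + R * t
    ≤R {s} t 1≤t = begin
      extensions³ v          ≤⟨ ∑³-bound r 1 (λ c b a → multicolored⁻ (a Vec.∷ b Vec.∷ c Vec.∷ v) λ _ _ → ≤-refl) ⟩
      r * (r * (r * 1))      ≡⟨ cong (λ t → r * (r * t)) (*-identityʳ r) ⟩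
      R                      ≡⟨ *-identityʳ R ⟨
      R * 1                  ≤⟨ *-monoʳ-≤ R 1≤t ⟩
      R * t                  ≤⟨ m≤n+m _ s ⟩
      s + R * t              ∎
      where open ≤-Reasoning
    bound : (f : Dec (Rainbow3APFree v)) (t : Dec (TwoColoring v))
      (u₀ : Dec (Unconstrained 0 v)) (u₁ : Dec (Unconstrained 1 v)) (u₂ : Dec (Unconstrained 2 v)) →
      extensions³ v ≤ 7 * (𝟙 f * 𝟙 (¬? t)) + R * (𝟙 f * 𝟙 u₀ + (𝟙 f * 𝟙 u₁ + 𝟙 f * 𝟙 u₂))
    bound (no ¬f) _ _ _ _ = ≤-trans
      (∑³-bound r 0 λ c b a → multicolored⁻ (a Vec.∷ b Vec.∷ c Vec.∷ v) λ free _ →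
        contradiction (rainbow3APFree-tail c v (rainbow3APFree-tail b (c Vec.∷ v) (rainbow3APFree-tail a (b Vec.∷ c Vec.∷ v) free))) ¬f)
      (≤-reflexive (trans (cong (λ t → r * (r * t)) (*-zeroʳ r)) (trans (cong (r *_) (*-zeroʳ r)) (trans (*-zeroʳ r) (sym (*-zeroʳ R))))))
    bound (yes _) t (yes _) u₁ u₂ = ≤R (1 + (1 * 𝟙 u₁ + 1 * 𝟙 u₂)) (s≤s z≤n)
    bound (yes _) t (no _) (yes _) u₂ = ≤R (1 + 1 * 𝟙 u₂) (s≤s z≤n)
    bound (yes _) t (no _) (no _) (yes _) = ≤R 1 ≤-refl
    bound (yes _) (yes two) (no ¬u₀) (no ¬u₁) (no ¬u₂) = ≤-trans
      (extensions³-two v two (constrained⇒bichromatic 0 v ¬u₀) (constrained⇒bichromatic 1 v ¬u₁) (constrained⇒bichromatic 2 v ¬u₂)) z≤n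
    bound (yes _) (no ¬two) (no ¬u₀) (no ¬u₁) (no ¬u₂) = ≤-trans
      (extensions³-transversal v (transversal v ¬two ¬u₀ ¬u₁ ¬u₂)) (m≤m+n 7 (R * 0))

  gNonTwo-∑ : ∀ r n → gNonTwo r n ≡ ∑ (allColorings r n) multicolored
  gNonTwo-∑ r n = length-filter-free r n (λ c → ¬? (twoColoring? c))

  ∑-allColorings-3+ : ∀ r n w → ∑ (allColorings r (3 + n)) w ≡
    ∑ (allColorings r n) (λ v → ∑³ r λ c b a → w (a Vec.∷ b Vec.∷ c Vec.∷ v))
  ∑-allColorings-3+ r n w = begin
    ∑ (allColorings r (3 + n)) w
      ≡⟨ ∑-allColorings-suc r (2 + n) w ⟩
    ∑ (allColorings r (2 + n)) (λ v → ∑ (allFin r) λ a → w (a Vec.∷ v))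
      ≡⟨ ∑-allColorings-suc r (1 + n) (λ v → ∑ (allFin r) λ a → w (a Vec.∷ v)) ⟩
    ∑ (allColorings r (1 + n)) (λ v → ∑ (allFin r) λ b → ∑ (allFin r) λ a → w (a Vec.∷ b Vec.∷ v))
      ≡⟨ ∑-allColorings-suc r n (λ v → ∑ (allFin r) λ b → ∑ (allFin r) λ a → w (a Vec.∷ b Vec.∷ v)) ⟩
    ∑ (allColorings r n) (λ v → ∑³ r λ c b a → w (a Vec.∷ b Vec.∷ c Vec.∷ v)) ∎
    where open ≡-Reasoning

  gNonTwo-recurrence : ∀ r n → gNonTwo r (3 + suc n) ≤ 7 * gNonTwo r (suc n) +
    r * (r * r) * (unconstrained 0 r (suc n) + (unconstrained 1 r (suc n) + unconstrained 2 r (suc n)))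
  gNonTwo-recurrence r n′ = go (suc n′) extensions³-bound
    where
    open ≤-Reasoning
    R = r * (r * r)
    u : ∀ {n} j → Coloring r n → ℕ
    u j v = 𝟙 (rainbow3APFree? v) * 𝟙 (unconstrained? j v)
    go : ∀ n → (∀ (v : Coloring r n) → extensions³ v ≤ 7 * multicolored v + R * (u 0 v + (u 1 v + u 2 v))) →
      gNonTwo r (3 + n) ≤ 7 * gNonTwo r n + R * (unconstrained 0 r n + (unconstrained 1 r n + unconstrained 2 r n))
    go n bound = begin
      gNonTwo r (3 + n)
        ≡⟨ gNonTwo-∑ r (3 + n) ⟩
      ∑ (allColorings r (3 + n)) multicolored
        ≡⟨ ∑-allColorings-3+ r n multicolored ⟩
      ∑ (allColorings r n) extensions³
        ≤⟨ ∑-mono (allColorings r n) bound ⟩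
      ∑ (allColorings r n) (λ v → 7 * multicolored v + R * (u 0 v + (u 1 v + u 2 v)))
        ≡⟨ trans (∑-+ (allColorings r n) _ _) (cong₂ _+_ (∑-*ˡ (allColorings r n) 7 _) (∑-*ˡ (allColorings r n) R _)) ⟩
      7 * ∑ (allColorings r n) multicolored + R * ∑ (allColorings r n) (λ v → u 0 v + (u 1 v + u 2 v))
        ≡⟨ cong₂ (λ s t → 7 * s + R * t) (sym (gNonTwo-∑ r n))
             (trans (∑-+ (allColorings r n) _ _) (cong₂ _+_ (sym (length-filter-free r n (unconstrained? 0)))
               (trans (∑-+ (allColorings r n) _ _) (cong₂ _+_ (sym (length-filter-free r n (unconstrained? 1)))
                 (sym (length-filter-free r n (unconstrained? 2))))))) ⟩
      7 * gNonTwo r n + R * (unconstrained 0 r n + (unconstrained 1 r n + unconstrained 2 r n)) ∎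

open Recurrence

-- Exact number of colorings with at most two colors

module TwoColored where
  open Nat using (_+_; _*_)
  private variable
    r n : ℕ

  used? : ∀ (v : Coloring r n) k → Dec (∃[ x ] lookup v x ≡ k)
  used? v k = any? λ x → lookup v x ≟ᶠ k

  #colors : Coloring r n → ℕ
  #colors v = length (usedColors v)

  #colors-∷-used : ∀ k (v : Coloring r n) → ∃[ x ] lookup v x ≡ k → #colors (k Vec.∷ v) ≡ #colors v
  #colors-∷-used k v (x , vx≡k) = ≤-antisym
    (length-usedColors-≤ (k Vec.∷ v) (usedColors v) λ where
      zero    → subst (_∈ usedColors v) vx≡k (∈-usedColors⁺ v x)
      (suc y) → ∈-usedColors⁺ v y)
    (length-usedColors-≤ v (usedColors (k Vec.∷ v)) λ y → ∈-usedColors⁺ (k Vec.∷ v) (suc y))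

  #colors-∷-new : ∀ k (v : Coloring r n) → ¬ (∃[ x ] lookup v x ≡ k) → #colors (k Vec.∷ v) ≡ suc (#colors v)
  #colors-∷-new k v new = ≤-antisym
    (length-usedColors-≤ (k Vec.∷ v) (k ∷ usedColors v) λ where
      zero    → here refl
      (suc y) → there (∈-usedColors⁺ v y))
    (length-⊆ (All.tabulate k∉ ∷ usedColors-unique v) ⊆used)
    where
    k∉ : ∀ {k′} → k′ ∈ usedColors v → k ≢ k′
    k∉ k′∈ refl = new (∈-usedColors⁻ v k′∈)
    ⊆used : k ∷ usedColors v ⊆ usedColors (k Vec.∷ v)
    ⊆used (here refl) = ∈-usedColors⁺ (k Vec.∷ v) zero
    ⊆used (there k′∈) with ∈-usedColors⁻ v k′∈
    ... | x , refl = ∈-usedColors⁺ (k Vec.∷ v) (suc x)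

  atMost : ℕ → Coloring r n → ℕ
  atMost t v = 𝟙 (#colors v ≤? t)

  -- A used letter leaves the number of colors unchanged; a new one raises it by one, which lowers
  -- the bound left for `v` from `suc t` to `t`.
  atMost-∷ : ∀ t k (v : Coloring r n) → atMost (suc t) (k Vec.∷ v) ≡
    atMost (suc t) v * 𝟙 (used? v k) + atMost t v * 𝟙 (¬? (used? v k))
  atMost-∷ t k v = by-use (used? v k)
    where
    by-use : (d : Dec (∃[ x ] lookup v x ≡ k)) → atMost (suc t) (k Vec.∷ v) ≡
      atMost (suc t) v * 𝟙 d + atMost t v * 𝟙 (¬? d)
    by-use (yes u) = trans (cong (λ c → 𝟙 (c ≤? suc t)) (#colors-∷-used k v u))
      (trans (sym (*-identityʳ _)) (trans (sym (+-identityʳ _)) (cong (atMost (suc t) v * 1 +_) (sym (*-zeroʳ (atMost t v))))))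
    by-use (no new) = trans (cong (λ c → 𝟙 (c ≤? suc t)) (#colors-∷-new k v new))
      (trans (shift (#colors v)) (trans (sym (*-identityʳ _)) (cong (_+ atMost t v * 1) (sym (*-zeroʳ (atMost (suc t) v))))))
      where
      shift : ∀ c → 𝟙 (suc c ≤? suc t) ≡ 𝟙 (c ≤? t)
      shift c = ≤-antisym (𝟙-mono (suc c ≤? suc t) (c ≤? t) s≤s⁻¹) (𝟙-mono (c ≤? t) (suc c ≤? suc t) s≤s)

  #new : Coloring r n → ℕ
  #new {r} v = ∑ (allFin r) λ k → 𝟙 (¬? (used? v k))

  #colors+#new : ∀ (v : Coloring r n) → #colors v + #new v ≡ r
  #colors+#new {r} v = begin
    #colors v + #new v
      ≡⟨ cong (_+ #new v) (length-filter-∑ (used? v) (allFin r)) ⟩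
    ∑ (allFin r) (λ k → 𝟙 (used? v k)) + #new v
      ≡⟨ ∑-+ (allFin r) (λ k → 𝟙 (used? v k)) (λ k → 𝟙 (¬? (used? v k))) ⟨
    ∑ (allFin r) (λ k → 𝟙 (used? v k) + 𝟙 (¬? (used? v k)))
      ≡⟨ ∑-cong (allFin r) (λ k → 𝟙-¬ (used? v k)) ⟩
    ∑ (allFin r) (λ _ → 1)
      ≡⟨ trans (∑-allFin-const r 1) (*-identityʳ r) ⟩
    r ∎
    where
    open ≡-Reasoning
    𝟙-¬ : {P : Set} (d : Dec P) → 𝟙 d + 𝟙 (¬? d) ≡ 1
    𝟙-¬ (yes _) = refl
    𝟙-¬ (no _)  = refl

  ∑-atMost-∷ : ∀ t (v : Coloring r n) → ∑ (allFin r) (λ k → atMost (suc t) (k Vec.∷ v)) ≡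
    atMost (suc t) v * #colors v + atMost t v * #new v
  ∑-atMost-∷ {r} t v = begin
    ∑ (allFin r) (λ k → atMost (suc t) (k Vec.∷ v))
      ≡⟨ ∑-cong (allFin r) (λ k → atMost-∷ t k v) ⟩
    ∑ (allFin r) (λ k → atMost (suc t) v * 𝟙 (used? v k) + atMost t v * 𝟙 (¬? (used? v k)))
      ≡⟨ ∑-+ (allFin r) (λ k → atMost (suc t) v * 𝟙 (used? v k)) (λ k → atMost t v * 𝟙 (¬? (used? v k))) ⟩
    ∑ (allFin r) (λ k → atMost (suc t) v * 𝟙 (used? v k)) + ∑ (allFin r) (λ k → atMost t v * 𝟙 (¬? (used? v k)))
      ≡⟨ cong₂ _+_ (∑-*ˡ (allFin r) (atMost (suc t) v) (λ k → 𝟙 (used? v k))) (∑-*ˡ (allFin r) (atMost t v) (λ k → 𝟙 (¬? (used? v k)))) ⟩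
    atMost (suc t) v * ∑ (allFin r) (λ k → 𝟙 (used? v k)) + atMost t v * #new v
      ≡⟨ cong (λ s → atMost (suc t) v * s + atMost t v * #new v) (length-filter-∑ (used? v) (allFin r)) ⟨
    atMost (suc t) v * #colors v + atMost t v * #new v ∎
    where open ≡-Reasoning

  #colors-[] : #colors {r} Vec.[] ≡ 0
  #colors-[] {r} = n≤0⇒n≡0 (length-usedColors-≤ {r = r} Vec.[] [] λ ())

  #colors-≥1 : ∀ (v : Coloring r (suc n)) → 1 ≤ #colors v
  #colors-≥1 v = ∈-length (∈-usedColors⁺ v zero)

  #atMost : ℕ → ℕ → ℕ → ℕ
  #atMost t r n = ∑ (allColorings r n) (atMost t)

  #atMost-suc : ∀ t r n (w : Coloring r n → ℕ) →
    (∀ v → atMost (suc t) v * #colors v + atMost t v * #new v ≡ w v) →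
    #atMost (suc t) r (suc n) ≡ ∑ (allColorings r n) w
  #atMost-suc t r n w w≡ = trans (∑-allColorings-suc r n (atMost (suc t)))
    (∑-cong (allColorings r n) λ v → trans (∑-atMost-∷ t v) (w≡ v))

  #atMost-1 : ∀ t r → #atMost (suc t) r 1 ≡ r
  #atMost-1 t r = trans (#atMost-suc t r 0 (λ _ → r) λ { Vec.[] → base }) (+-identityʳ r)
    where
    open ≡-Reasoning
    base : atMost (suc t) (Vec.[] {A = Fin r}) * #colors (Vec.[] {A = Fin r}) + atMost t (Vec.[] {A = Fin r}) * #new (Vec.[] {A = Fin r}) ≡ r
    base = begin
      atMost (suc t) ε * #colors ε + atMost t ε * #new ε
        ≡⟨ cong₂ (λ a b → atMost (suc t) ε * a + b * #new ε) (#colors-[] {r}) (𝟙-yes (#colors ε ≤? t) (subst (_≤ t) (sym (#colors-[] {r})) z≤n)) ⟩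
      atMost (suc t) ε * 0 + 1 * #new ε
        ≡⟨ cong₂ _+_ (*-zeroʳ (atMost (suc t) ε)) (*-identityˡ (#new ε)) ⟩
      #new ε
        ≡⟨ trans (cong (_+ #new ε) (sym (#colors-[] {r}))) (#colors+#new ε) ⟩
      r ∎
      where
      ε : Coloring r 0
      ε = Vec.[]

  -- Only its own color keeps a nonempty monochromatic word monochromatic, so the count does not
  -- change with the length.
  #monochromatic : ∀ r n → #atMost 1 r (suc n) ≡ r
  #monochromatic r zero    = #atMost-1 0 r
  #monochromatic r (suc n) = trans (#atMost-suc 0 r (suc n) (atMost 1) λ v → count (#colors v) (#new v) (#colors-≥1 v))
    (#monochromatic r n)
    where
    count : ∀ c w → 1 ≤ c → 𝟙 (c ≤? 1) * c + 𝟙 (c ≤? 0) * w ≡ 𝟙 (c ≤? 1)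
    count 1             w _ = refl
    count (suc (suc c)) w _ = refl

  2*[2+s]C2 : ∀ s → 2 * ((2 + s) C 2) ≡ (2 + s) * (1 + s)
  2*[2+s]C2 zero    = refl
  2*[2+s]C2 (suc s) = begin
    2 * ((3 + s) C 2)                 ≡⟨ cong (2 *_) (nCk+nC[k+1]≡[n+1]C[k+1] (2 + s) 1) ⟨
    2 * ((2 + s) C 1 + (2 + s) C 2)   ≡⟨ cong (λ t → 2 * (t + (2 + s) C 2)) (nC1≡n (2 + s)) ⟩
    2 * ((2 + s) + (2 + s) C 2)       ≡⟨ *-distribˡ-+ 2 (2 + s) ((2 + s) C 2) ⟩
    2 * (2 + s) + 2 * ((2 + s) C 2)   ≡⟨ cong (2 * (2 + s) +_) (2*[2+s]C2 s) ⟩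
    2 * (2 + s) + (2 + s) * (1 + s)   ≡⟨ expand s ⟩
    (3 + s) * (2 + s)                 ∎
    where
    open ≡-Reasoning
    expand : ∀ s → 2 * (2 + s) + (2 + s) * (1 + s) ≡ (3 + s) * (2 + s)
    expand = solve-∀

  -- Summing 2^(n + 1) over all pairs of the 2 + s colors counts each monochromatic coloring 1 + s
  -- times instead of once, an excess of (2 + s) s. The induction uses that a word with exactly two
  -- colors has 2 admissible extensions and a monochromatic one has 2 + s.
  #twoColored : ∀ s n → #atMost 2 (2 + s) (suc n) + (2 + s) * s ≡ ((2 + s) C 2) * 2 ^ suc n
  #twoColored s zero = begin
    #atMost 2 (2 + s) 1 + (2 + s) * s     ≡⟨ cong (_+ (2 + s) * s) (#atMost-1 1 (2 + s)) ⟩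
    (2 + s) + (2 + s) * s                 ≡⟨ *-suc (2 + s) s ⟨
    (2 + s) * (1 + s)                     ≡⟨ 2*[2+s]C2 s ⟨
    2 * ((2 + s) C 2)                     ≡⟨ *-comm 2 ((2 + s) C 2) ⟩
    ((2 + s) C 2) * 2                     ∎
    where open ≡-Reasoning
  #twoColored s (suc n) = begin
    #atMost 2 k (2 + n) + k * s
      ≡⟨ cong (_+ k * s) (#atMost-suc 1 k (suc n) (λ v → 2 * atMost 2 v + s * atMost 1 v)
           λ v → count (#colors v) (#new v) (#colors-≥1 v) (#colors+#new v)) ⟩
    ∑ (allColorings k (suc n)) (λ v → 2 * atMost 2 v + s * atMost 1 v) + k * s
      ≡⟨ cong (_+ k * s) (trans (∑-+ (allColorings k (suc n)) (λ v → 2 * atMost 2 v) (λ v → s * atMost 1 v))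
           (cong₂ _+_ (∑-*ˡ (allColorings k (suc n)) 2 (atMost 2)) (∑-*ˡ (allColorings k (suc n)) s (atMost 1)))) ⟩
    2 * #atMost 2 k (suc n) + s * #atMost 1 k (suc n) + k * s
      ≡⟨ cong (λ t → 2 * #atMost 2 k (suc n) + s * t + k * s) (#monochromatic k n) ⟩
    2 * #atMost 2 k (suc n) + s * k + k * s
      ≡⟨ collect (#atMost 2 k (suc n)) s k ⟩
    2 * (#atMost 2 k (suc n) + k * s)
      ≡⟨ cong (2 *_) (#twoColored s n) ⟩
    2 * ((k C 2) * 2 ^ suc n)
      ≡⟨ swap (k C 2) (2 ^ suc n) ⟩
    (k C 2) * 2 ^ suc (suc n) ∎
    where
    open ≡-Reasoning
    k = 2 + s
    collect : ∀ a s r → 2 * a + s * r + r * s ≡ 2 * (a + r * s)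
    collect = solve-∀
    swap : ∀ a b → 2 * (a * b) ≡ a * (2 * b)
    swap = solve-∀
    count : ∀ c w → 1 ≤ c → c + w ≡ 2 + s → 𝟙 (c ≤? 2) * c + 𝟙 (c ≤? 1) * w ≡ 2 * 𝟙 (c ≤? 2) + s * 𝟙 (c ≤? 1)
    count 1 w _ c+w = trans (cong (1 +_) (trans (+-identityʳ w) (suc-injective c+w))) (cong (2 +_) (sym (*-identityʳ s)))
    count 2 w _ _ = cong (2 +_) (sym (*-zeroʳ s))
    count (suc (suc (suc c))) w _ _ = sym (*-zeroʳ s)

  g≡two+multi : ∀ r n → g r n ≡ #atMost 2 r n + gNonTwo r n
  g≡two+multi r n = begin
    g r n                                               ≡⟨ length-filter-∑ rainbow3APFree? (allColorings r n) ⟩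
    ∑ (allColorings r n) (λ v → 𝟙 (rainbow3APFree? v))  ≡⟨ ∑-cong (allColorings r n) split ⟩
    ∑ (allColorings r n) (λ v → atMost 2 v + multicolored v) ≡⟨ ∑-+ (allColorings r n) (atMost 2) multicolored ⟩
    #atMost 2 r n + ∑ (allColorings r n) multicolored   ≡⟨ cong (#atMost 2 r n +_) (gNonTwo-∑ r n) ⟨
    #atMost 2 r n + gNonTwo r n                         ∎
    where
    open ≡-Reasoning
    split : ∀ v → 𝟙 (rainbow3APFree? v) ≡ 𝟙 (twoColoring? v) + 𝟙 (rainbow3APFree? v) * 𝟙 (¬? (twoColoring? v))
    split v = by-case (rainbow3APFree? v) (twoColoring? v)
      where
      by-case : (f : Dec (Rainbow3APFree v)) (t : Dec (TwoColoring v)) → 𝟙 f ≡ 𝟙 t + 𝟙 f * 𝟙 (¬? t)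
      by-case (yes _) (yes _)   = refl
      by-case (yes _) (no _)    = refl
      by-case (no ¬f) (yes two) = contradiction (twoColoring⇒free v two) ¬f
      by-case (no _)  (no _)    = refl

  -- With the main term exact, both asymptotic claims reduce to `gNonTwo` being o(2ⁿ).
  g-exact : ∀ s n → g (2 + s) (suc n) + (2 + s) * s ≡ ((2 + s) C 2) * 2 ^ suc n + gNonTwo (2 + s) (suc n)
  g-exact s n = begin
    g k (suc n) + k * s                             ≡⟨ cong (_+ k * s) (g≡two+multi k (suc n)) ⟩
    #atMost 2 k (suc n) + gNonTwo k (suc n) + k * s ≡⟨ shuffle (#atMost 2 k (suc n)) _ _ ⟩
    #atMost 2 k (suc n) + k * s + gNonTwo k (suc n) ≡⟨ cong (_+ gNonTwo k (suc n)) (#twoColored s n) ⟩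
    (k C 2) * 2 ^ suc n + gNonTwo k (suc n)         ∎
    where
    open ≡-Reasoning
    k = 2 + s
    shuffle : ∀ a b c → a + b + c ≡ a + c + b
    shuffle = solve-∀

  -- A monochromatic coloring is free; this makes `g` a legitimate denominator of the second error
  -- term.
  g>0 : ∀ r n → 0 < g (suc r) n
  g>0 r n = ∈-length (∈-free⁺ (Vec.replicate n zero)
    (twoColoring⇒free (Vec.replicate n zero) (twoColoring-pair (Vec.replicate n zero) {zero} {zero} λ x → inj₁ (lookup-replicate x zero))))

open TwoColored

-- Growth rates derived from the recurrences

module Growth where
  open Nat using (_+_; _*_)
  bounded-below : ∀ (f : ℕ → ℕ) m → ∃[ K ] (∀ n → n ≤ m → f n ≤ K)
  bounded-below f zero    = f 0 , λ { zero z≤n → ≤-refl }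
  bounded-below f (suc m) with bounded-below f m
  ... | K , f≤K = K + f (suc m) , λ n n≤1+m → case (m≤n⇒m<n∨m≡n n≤1+m)
    where
    case : ∀ {n} → n < suc m ⊎ n ≡ suc m → f n ≤ K + f (suc m)
    case (inj₁ (s≤s n≤m)) = ≤-trans (f≤K _ n≤m) (m≤m+n K _)
    case (inj₂ refl)      = m≤n+m _ K

  n≤3^n : ∀ n → n ≤ 3 ^ n
  n≤3^n zero    = z≤n
  n≤3^n (suc n) = begin
    1 + n             ≤⟨ +-mono-≤ (m^n>0 3 n) (n≤3^n n) ⟩
    3 ^ n + 3 ^ n     ≤⟨ +-monoʳ-≤ (3 ^ n) (m≤m+n _ _) ⟩
    3 ^ suc n         ∎
    where open ≤-Reasoning

  -- For large n the halved term is at most K 3^(2 + n); together with twice the previous bound it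
  -- makes up the factor 3.
  halving-growth : ∀ (T : ℕ → ℕ) R → (∀ n → T (3 + n) ≤ 2 * T (2 + n) + R * T (1 + ⌊ n /2⌋)) →
    ∃[ K ] (∀ n → T n ≤ K * 3 ^ n)
  halving-growth T R T-rec = K , <-rec _ step
    where
    open ≤-Reasoning
    -- Beyond this threshold the argument is 3 + m with m ≥ 2 R, whence R ≤ 3^R ≤ 3^⌈m/2⌉.
    n₀ = 2 + 2 * R
    K = proj₁ (bounded-below T n₀)
    large : ∀ n → 2 * R ≤ n → R * 3 ^ (1 + ⌊ n /2⌋) ≤ 3 ^ (2 + n)
    large n 2R≤n = begin
      R * 3 ^ (1 + ⌊ n /2⌋)              ≤⟨ *-monoˡ-≤ (3 ^ (1 + ⌊ n /2⌋)) (begin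
        R             ≤⟨ n≤3^n R ⟩
        3 ^ R         ≤⟨ ^-monoʳ-≤ 3 (begin
          R             ≡⟨ n≡⌈n+n/2⌉ R ⟩
          ⌈ R + R /2⌉   ≡⟨ cong (λ t → ⌈ R + t /2⌉) (+-identityʳ R) ⟨
          ⌈ 2 * R /2⌉   ≤⟨ ⌈n/2⌉-mono 2R≤n ⟩
          ⌈ n /2⌉       ∎) ⟩
        3 ^ ⌈ n /2⌉   ∎) ⟩
      3 ^ ⌈ n /2⌉ * 3 ^ (1 + ⌊ n /2⌋)    ≡⟨ ^-distribˡ-+-* 3 ⌈ n /2⌉ (1 + ⌊ n /2⌋) ⟨
      3 ^ (⌈ n /2⌉ + (1 + ⌊ n /2⌋))      ≡⟨ cong (3 ^_) (trans (+-suc ⌈ n /2⌉ ⌊ n /2⌋) (cong suc (trans (+-comm ⌈ n /2⌉ ⌊ n /2⌋) (⌊n/2⌋+⌈n/2⌉≡n n)))) ⟩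
      3 ^ (1 + n)                        ≤⟨ ^-monoʳ-≤ 3 (n≤1+n (1 + n)) ⟩
      3 ^ (2 + n)                        ∎
    step : ∀ n → (∀ {m} → m < n → T m ≤ K * 3 ^ m) → T n ≤ K * 3 ^ n
    step n rec with n ≤? n₀
    ... | yes n≤n₀ = begin
      T n         ≤⟨ proj₂ (bounded-below T n₀) n n≤n₀ ⟩
      K           ≡⟨ *-identityʳ K ⟨
      K * 1       ≤⟨ *-monoʳ-≤ K (m^n>0 3 n) ⟩
      K * 3 ^ n   ∎
    ... | no n≰n₀ with n | ≰⇒> n≰n₀
    ...   | suc (suc (suc m)) | s≤s (s≤s (s≤s 2R≤m)) = begin
      T (3 + m)                                            ≤⟨ T-rec m ⟩
      2 * T (2 + m) + R * T (1 + ⌊ m /2⌋)                  ≤⟨ +-mono-≤ (*-monoʳ-≤ 2 (rec ≤-refl)) (*-monoʳ-≤ R (rec (s≤s (s≤s (m≤n⇒m≤1+n (⌊n/2⌋≤n m)))))) ⟩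
      2 * (K * 3 ^ (2 + m)) + R * (K * 3 ^ (1 + ⌊ m /2⌋))  ≡⟨ cong (2 * (K * 3 ^ (2 + m)) +_) (swap R K _) ⟩
      2 * (K * 3 ^ (2 + m)) + K * (R * 3 ^ (1 + ⌊ m /2⌋))  ≤⟨ +-monoʳ-≤ (2 * (K * 3 ^ (2 + m))) (*-monoʳ-≤ K (large m 2R≤m)) ⟩
      2 * (K * 3 ^ (2 + m)) + K * 3 ^ (2 + m)              ≡⟨ triple K (3 ^ (2 + m)) ⟩
      K * 3 ^ (3 + m)                                      ∎
      where
      swap : ∀ a b c → a * (b * c) ≡ b * (a * c)
      swap = solve-∀
      triple : ∀ a b → 2 * (a * b) + a * b ≡ a * (3 * b)
      triple = solve-∀

  -- Two steps in `m` multiply the left side by 27 and the right side by 36. The base 6 stays below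
  -- the 7 of `seventh-growth`.
  3^half≤6^third : ∀ s m → 3 ^ ⌊ m * 3 + s /2⌋ ≤ 3 ^ s * 6 ^ m
  3^half≤6^third s 0 = ≤-trans (^-monoʳ-≤ 3 (⌊n/2⌋≤n s)) (≤-reflexive (sym (*-identityʳ _)))
  3^half≤6^third s 1 = begin
    3 * 3 ^ ⌊ suc s /2⌋   ≤⟨ *-monoʳ-≤ 3 (^-monoʳ-≤ 3 (⌈n/2⌉≤n s)) ⟩
    3 * 3 ^ s             ≤⟨ *-monoˡ-≤ (3 ^ s) {3} {6} (s≤s (s≤s (s≤s z≤n))) ⟩
    6 * 3 ^ s             ≡⟨ *-comm 6 (3 ^ s) ⟩
    3 ^ s * 6             ∎
    where open ≤-Reasoning
  3^half≤6^third s (suc (suc m)) = begin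
    27′ (3 ^ ⌊ m * 3 + s /2⌋)     ≡⟨ 27× (3 ^ ⌊ m * 3 + s /2⌋) ⟩
    27 * 3 ^ ⌊ m * 3 + s /2⌋      ≤⟨ *-mono-≤ {27} {36} (m≤m+n 27 9) (3^half≤6^third s m) ⟩
    36 * (3 ^ s * 6 ^ m)          ≡⟨ 36× (3 ^ s) (6 ^ m) ⟩
    3 ^ s * 6 ^ (2 + m)           ∎
    where
    open ≤-Reasoning
    27′ : ℕ → ℕ
    27′ x = 3 * (3 * (3 * x))
    27× : ∀ x → 3 * (3 * (3 * x)) ≡ 27 * x
    27× = solve-∀
    36× : ∀ x y → 36 * (x * y) ≡ x * (6 * (6 * y))
    36× = solve-∀

  -- On each residue class modulo 3 the recurrence has order one and factor 7, and its inhomogeneous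
  -- term is dominated by a multiple of 6^m. The constant `M` bounds the three initial values.
  seventh-growth : ∀ (N : ℕ → ℕ) D → (∀ n → N (3 + n) ≤ 7 * N n + D * 3 ^ ⌊ n /2⌋) →
    ∃[ M ] (∀ n → N n ≤ M * 7 ^ (n / 3))
  seventh-growth N D N-rec = M , bound
    where
    open ≤-Reasoning
    initial : ℕ → ℕ
    initial s = N s + D * 3 ^ s
    M = proj₁ (bounded-below initial 2)
    -- The summand in 6 ^ m absorbs the inhomogeneous term of the recurrence.
    progression : ∀ s m → N (m * 3 + s) + D * 3 ^ s * 6 ^ m ≤ initial s * 7 ^ m
    progression s zero    = ≤-reflexive (trans (cong (N s +_) (*-identityʳ _)) (sym (*-identityʳ _)))
    progression s (suc m) = begin
      N (3 + (m * 3 + s)) + D * 3 ^ s * 6 ^ suc m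
        ≤⟨ +-monoˡ-≤ _ (N-rec (m * 3 + s)) ⟩
      7 * N (m * 3 + s) + D * 3 ^ ⌊ m * 3 + s /2⌋ + D * 3 ^ s * 6 ^ suc m
        ≤⟨ +-monoˡ-≤ _ (+-monoʳ-≤ (7 * N (m * 3 + s)) (*-monoʳ-≤ D (3^half≤6^third s m))) ⟩
      7 * N (m * 3 + s) + D * (3 ^ s * 6 ^ m) + D * 3 ^ s * 6 ^ suc m
        -- One copy of the absorbing summand from the recurrence and six from `6 ^ suc m` make
        -- seven.
        ≡⟨ collect (N (m * 3 + s)) D (3 ^ s) (6 ^ m) ⟩
      7 * (N (m * 3 + s) + D * 3 ^ s * 6 ^ m)
        ≤⟨ *-monoʳ-≤ 7 (progression s m) ⟩
      7 * (initial s * 7 ^ m)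
        ≡⟨ swap (initial s) (7 ^ m) ⟩
      initial s * 7 ^ suc m ∎
      where
      collect : ∀ a d x y → 7 * a + d * (x * y) + d * x * (6 * y) ≡ 7 * (a + d * x * y)
      collect = solve-∀
      swap : ∀ a b → 7 * (a * b) ≡ a * (7 * b)
      swap = solve-∀
    bound : ∀ n → N n ≤ M * 7 ^ (n / 3)
    bound n = begin
      N n                                         ≡⟨ cong N (trans (m≡m%n+[m/n]*n n 3) (+-comm (n % 3) _)) ⟩
      N (n / 3 * 3 + n % 3)                       ≤⟨ m≤m+n _ _ ⟩
      N (n / 3 * 3 + n % 3) + D * 3 ^ (n % 3) * 6 ^ (n / 3) ≤⟨ progression (n % 3) (n / 3) ⟩
      initial (n % 3) * 7 ^ (n / 3)                 ≤⟨ *-monoˡ-≤ (7 ^ (n / 3)) (proj₂ (bounded-below initial 2) (n % 3) (s≤s⁻¹ (m%n<n n 3))) ⟩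
      M * 7 ^ (n / 3)                             ∎

  -- Bernoulli's inequality (8/7)^a ≥ 1 + a/7 with denominators cleared.
  7^a[7+a]≤7*8^a : ∀ a → 7 ^ a * (7 + a) ≤ 7 * 8 ^ a
  7^a[7+a]≤7*8^a zero    = ≤-refl
  7^a[7+a]≤7*8^a (suc a) = begin
    7 * 7 ^ a * (8 + a)              ≤⟨ m≤m+n _ (7 ^ a * a) ⟩
    7 * 7 ^ a * (8 + a) + 7 ^ a * a  ≡⟨ collect (7 ^ a) a ⟩
    8 * (7 ^ a * (7 + a))            ≤⟨ *-monoʳ-≤ 8 (7^a[7+a]≤7*8^a a) ⟩
    8 * (7 * 8 ^ a)                  ≡⟨ swap (8 ^ a) ⟩
    7 * 8 ^ suc a                    ∎
    where
    open ≤-Reasoning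
    collect : ∀ x a → 7 * x * (8 + a) + x * a ≡ 8 * (x * (7 + a))
    collect = solve-∀
    swap : ∀ x → 8 * (7 * x) ≡ 7 * (8 * x)
    swap = solve-∀

  -- This is N(n) = o(2ⁿ), with 1/q in the role of ε and denominators cleared.
  Negligible : (ℕ → ℕ) → Set
  Negligible N = ∀ q → ∃[ n₀ ] (∀ n → n₀ ≤ n → q * N n < 2 ^ n)

  -- By Bernoulli's inequality 7^(n/3) is o(8^(n/3)), and 8^(n/3) ≤ 2ⁿ. The constant `c` is absorbed
  -- into the coefficient, since 7^(n/3) ≥ 1.
  seventh-negligible : ∀ (N : ℕ → ℕ) M c → (∀ n → N (2 + n) ≤ M * 7 ^ (n / 3)) → Negligible (λ n → N n + c)
  -- From n ≥ 21 Y follows n / 3 ≥ 7 Y, where `power` applies; the summand 2 is the shift in the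
  -- argument of `N`.
  seventh-negligible N M c N≤ q = 2 + 7 * Y * 3 , λ { (suc (suc n)) (s≤s (s≤s Y≤n)) → bound n Y≤n }
    where
    open ≤-Reasoning
    Y = q * (M + c)
    power : ∀ a → 7 * Y ≤ a → Y * 7 ^ a < 8 ^ a
    power a 7Y≤a = *-cancelˡ-< 7 _ _ (begin-strict
      7 * (Y * 7 ^ a)   ≡⟨ swap Y (7 ^ a) ⟩
      7 ^ a * (7 * Y)   <⟨ *-monoʳ-< (7 ^ a) {{m^n≢0 7 a}} (≤-trans (s≤s 7Y≤a) (m≤n+m (suc a) 6)) ⟩
      7 ^ a * (6 + suc a) ≡⟨ cong (7 ^ a *_) (+-suc 6 a) ⟩
      7 ^ a * (7 + a)   ≤⟨ 7^a[7+a]≤7*8^a a ⟩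
      7 * 8 ^ a         ∎)
      where
      swap : ∀ a b → 7 * (a * b) ≡ b * (7 * a)
      swap = solve-∀
    bound : ∀ n → 7 * Y * 3 ≤ n → q * (N (2 + n) + c) < 2 ^ (2 + n)
    bound n Y≤n = begin-strict
      q * (N (2 + n) + c)                  ≤⟨ *-monoʳ-≤ q (+-mono-≤ (N≤ n) (begin
        c                      ≡⟨ *-identityʳ c ⟨
        c * 1                  ≤⟨ *-monoʳ-≤ c (m^n>0 7 (n / 3)) ⟩
        c * 7 ^ (n / 3)        ∎)) ⟩
      q * (M * 7 ^ (n / 3) + c * 7 ^ (n / 3)) ≡⟨ cong (q *_) (*-distribʳ-+ (7 ^ (n / 3)) M c) ⟨
      q * ((M + c) * 7 ^ (n / 3))          ≡⟨ *-assoc q (M + c) _ ⟨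
      Y * 7 ^ (n / 3)                      <⟨ power (n / 3) (≤-trans (≤-reflexive (sym (m*n/n≡m (7 * Y) 3))) (/-monoˡ-≤ 3 Y≤n)) ⟩
      8 ^ (n / 3)                          ≡⟨ ^-*-assoc 2 3 (n / 3) ⟩
      2 ^ (3 * (n / 3))                    ≤⟨ ^-monoʳ-≤ 2 (begin
        3 * (n / 3)            ≡⟨ *-comm 3 (n / 3) ⟩
        n / 3 * 3              ≤⟨ m≤n+m _ (n % 3) ⟩
        n % 3 + n / 3 * 3      ≡⟨ m≡m%n+[m/n]*n n 3 ⟨
        n                      ≤⟨ m≤n+m n 2 ⟩
        2 + n                  ∎) ⟩
      2 ^ (2 + n)                          ∎

open Growth

-- Quotients of integers as rational error terms

module Quotient where
  open import Data.Integer.Base using (+_)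
  open import Data.Rational.Base using (mkℚ; 0ℚ; toℚᵘ; ↧ₙ_)
  open import Data.Rational.Unnormalised.Base using (mkℚᵘ; *≡*; *<*)
  toℚᵘ-/ : ∀ z d → toℚᵘ (z ℚ./ suc d) ℚᵘ.≃ mkℚᵘ z d
  toℚᵘ-/ z d = ℚ.toℚᵘ-fromℚᵘ (mkℚᵘ z d)

  -- A positive ε with denominator q is at least 1/q, since its numerator is at least 1.
  ∣/∣<ε : ∀ z d .{{_ : NonZero d}} ε → 0ℚ ℚ.< ε → ↧ₙ ε Nat.* ℤ.∣ z ∣ < d → ℚ.∣ z ℚ./ d ∣ ℚ.< ε
  ∣/∣<ε z (suc d) (mkℚ (+ suc k) q-1 cop) 0<ε qz<d = ℚ.toℚᵘ-cancel-< (ℚᵘ.<-respˡ-≃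
    (ℚᵘ.≃-sym (ℚᵘ.≃-trans (ℚ.toℚᵘ-homo-∣-∣ (z ℚ./ suc d)) (ℚᵘ.∣-∣-cong (toℚᵘ-/ z d))))
    (*<* (subst₂ ℤ._<_ (ℤ.pos-* ℤ.∣ z ∣ (suc q-1)) (ℤ.pos-* (suc k) (suc d)) (ℤ.+<+ zq<kd))))
    where
    zq<kd : ℤ.∣ z ∣ Nat.* suc q-1 < suc k Nat.* suc d
    zq<kd = <-≤-trans (subst (_< suc d) (*-comm (suc q-1) ℤ.∣ z ∣) qz<d) (m≤m+n (suc d) (k Nat.* suc d))
  ∣/∣<ε z d (mkℚ (+ 0) q-1 cop) (ℚ.*<* (ℤ.+<+ ())) _
  ∣/∣<ε z d (mkℚ (ℤ.-[1+ _ ]) q-1 cop) (ℚ.*<* ()) _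

  /-*-cancel : ∀ z d .{{_ : NonZero d}} → z ℚ./ d ℚ.* fromℕ d ≡ z ℚ./ 1
  /-*-cancel z (suc d) = ℚ.toℚᵘ-injective (begin
    toℚᵘ (z ℚ./ suc d ℚ.* fromℕ (suc d))           ≈⟨ ℚ.toℚᵘ-homo-* (z ℚ./ suc d) (fromℕ (suc d)) ⟩
    toℚᵘ (z ℚ./ suc d) ℚᵘ.* toℚᵘ (fromℕ (suc d))   ≈⟨ ℚᵘ.*-cong (toℚᵘ-/ z d) (toℚᵘ-/ (+ suc d) 0) ⟩
    mkℚᵘ z d ℚᵘ.* mkℚᵘ (+ suc d) 0                 ≈⟨ *≡* (trans (ℤ.*-identityʳ _) (cong (λ t → z ℤ.* + suc t) (sym (*-identityʳ d)))) ⟩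
    mkℚᵘ z 0                                       ≈⟨ toℚᵘ-/ z 0 ⟨
    toℚᵘ (z ℚ./ 1)                                 ∎)
    where open ℚᵘ.≃-Reasoning

  /1-+ : ∀ x y → x ℚ./ 1 ℚ.+ y ℚ./ 1 ≡ (x ℤ.+ y) ℚ./ 1
  /1-+ x y = ℚ.toℚᵘ-injective (begin
    toℚᵘ (x ℚ./ 1 ℚ.+ y ℚ./ 1)            ≈⟨ ℚ.toℚᵘ-homo-+ (x ℚ./ 1) (y ℚ./ 1) ⟩
    toℚᵘ (x ℚ./ 1) ℚᵘ.+ toℚᵘ (y ℚ./ 1)    ≈⟨ ℚᵘ.+-cong (toℚᵘ-/ x 0) (toℚᵘ-/ y 0) ⟩
    mkℚᵘ x 0 ℚᵘ.+ mkℚᵘ y 0                ≈⟨ *≡* (cong (ℤ._* + 1) (cong₂ ℤ._+_ (ℤ.*-identityʳ x) (ℤ.*-identityʳ y))) ⟩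
    mkℚᵘ (x ℤ.+ y) 0                      ≈⟨ toℚᵘ-/ (x ℤ.+ y) 0 ⟨
    toℚᵘ ((x ℤ.+ y) ℚ./ 1)                ∎)
    where open ℚᵘ.≃-Reasoning

  /1-* : ∀ x y → x ℚ./ 1 ℚ.* (y ℚ./ 1) ≡ (x ℤ.* y) ℚ./ 1
  /1-* x y = ℚ.toℚᵘ-injective (begin
    toℚᵘ (x ℚ./ 1 ℚ.* (y ℚ./ 1))          ≈⟨ ℚ.toℚᵘ-homo-* (x ℚ./ 1) (y ℚ./ 1) ⟩
    toℚᵘ (x ℚ./ 1) ℚᵘ.* toℚᵘ (y ℚ./ 1)    ≈⟨ ℚᵘ.*-cong (toℚᵘ-/ x 0) (toℚᵘ-/ y 0) ⟩
    mkℚᵘ (x ℤ.* y) 0                      ≈⟨ toℚᵘ-/ (x ℤ.* y) 0 ⟨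
    toℚᵘ ((x ℤ.* y) ℚ./ 1)                ∎)
    where open ℚᵘ.≃-Reasoning

  factor : ∀ {a} p q d → a ≡ p ℚ.* d ℚ.+ q ℚ.* d → a ≡ (p ℚ.+ q) ℚ.* d
  factor p q d a≡ = trans a≡ (sym (ℚ.*-distribʳ-+ d p q))

  -- The absolute error `z` is turned into an error z / d relative to `d`.
  relative-error : ∀ a c d z .{{_ : NonZero d}} → + a ≡ + c ℤ.* + d ℤ.+ z →
    fromℕ a ≡ (fromℕ c ℚ.+ z ℚ./ d) ℚ.* fromℕ d
  relative-error a c d z a≡ = factor (fromℕ c) (z ℚ./ d) (fromℕ d) (trans split parts)
    where
    split : fromℕ a ≡ (+ c ℤ.* + d) ℚ./ 1 ℚ.+ z ℚ./ 1
    split = trans (cong (ℚ._/ 1) a≡) (sym (/1-+ (+ c ℤ.* + d) z))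
    parts : (+ c ℤ.* + d) ℚ./ 1 ℚ.+ z ℚ./ 1 ≡ fromℕ c ℚ.* fromℕ d ℚ.+ z ℚ./ d ℚ.* fromℕ d
    parts = sym (cong₂ ℚ._+_ (/1-* (+ c) (+ d)) (/-*-cancel z d))

open Quotient

-- The two error terms and their convergence to 0

module Asymptotics where
  open import Data.Integer.Base using (ℤ; +_; _⊖_)
  open import Data.Rational.Base using (ℚ; ↧ₙ_)
  open Nat using (_+_; _*_)
  g-growth : ∀ r → ∃[ K ] (∀ n → g r n ≤ K * 3 ^ n)
  g-growth r = halving-growth (g r) (r * (r * r)) λ n → begin
    g r (3 + n)                                         ≤⟨ g-suc r (2 + n) ⟩
    2 * g r (2 + n) + r * unconstrained 0 r (2 + n)     ≤⟨ +-monoʳ-≤ (2 * g r (2 + n)) (*-monoʳ-≤ r (unconstrained-count n r z≤n)) ⟩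
    2 * g r (2 + n) + r * (r * (r * g r (1 + ⌊ n /2⌋))) ≡⟨ cong (λ t → 2 * g r (2 + n) + t) (reassoc r (g r (1 + ⌊ n /2⌋))) ⟩
    2 * g r (2 + n) + r * (r * r) * g r (1 + ⌊ n /2⌋)   ∎
    where
    open ≤-Reasoning
    reassoc : ∀ r x → r * (r * (r * x)) ≡ r * (r * r) * x
    reassoc = solve-∀

  -- Lengths start at 2, where the separately recorded positions behind `unconstrained-count` exist.
  gNonTwo-growth : ∀ r → ∃[ M ] (∀ n → gNonTwo r (2 + n) ≤ M * 7 ^ (n / 3))
  gNonTwo-growth r = seventh-growth (λ n → gNonTwo r (2 + n)) D λ n → begin
    gNonTwo r (3 + (2 + n))
      ≤⟨ gNonTwo-recurrence r (1 + n) ⟩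
    7 * gNonTwo r (2 + n) + R * (U 0 n + (U 1 n + U 2 n))
      ≤⟨ +-monoʳ-≤ (7 * gNonTwo r (2 + n)) (*-monoʳ-≤ R (+-mono-≤ (U≤ z≤n n) (+-mono-≤ (U≤ (s≤s z≤n) n) (U≤ ≤-refl n)))) ⟩
    7 * gNonTwo r (2 + n) + R * (u n + (u n + u n))
      ≡⟨ cong (λ t → 7 * gNonTwo r (2 + n) + t) (collect R r K (3 ^ ⌊ n /2⌋)) ⟩
    7 * gNonTwo r (2 + n) + D * 3 ^ ⌊ n /2⌋ ∎
    where
    open ≤-Reasoning
    R = r * (r * r)
    K = proj₁ (g-growth r)
    -- In 9 = 3 · 3, one factor comes from the three types of edges, the other from the exponent 1 +
    -- ⌊n/2⌋.
    D = R * (9 * (r * (r * K)))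
    U : ℕ → ℕ → ℕ
    U j n = unconstrained j r (2 + n)
    u : ℕ → ℕ
    u n = r * (r * (K * 3 ^ (1 + ⌊ n /2⌋)))
    U≤ : ∀ {j} → j ≤ 2 → ∀ n → U j n ≤ u n
    U≤ j≤2 n = ≤-trans (unconstrained-count n r j≤2) (*-monoʳ-≤ r (*-monoʳ-≤ r (proj₂ (g-growth r) (1 + ⌊ n /2⌋))))
    collect : ∀ R r K x → R * (r * (r * (K * (3 * x))) + (r * (r * (K * (3 * x))) + r * (r * (K * (3 * x))))) ≡ R * (9 * (r * (r * K))) * x
    collect = solve-∀

  gNonTwo-negligible : ∀ r c → Negligible (λ n → gNonTwo r n + c)
  gNonTwo-negligible r c = seventh-negligible (gNonTwo r) (proj₁ (gNonTwo-growth r)) c (proj₂ (gNonTwo-growth r))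

  -- From a + c = b + d follows a - b = d - c, a difference of two natural numbers.
  ∣⊖∣≤ : ∀ a b c d → a + c ≡ b + d → ℤ.∣ a ⊖ b ∣ ≤ d + c
  ∣⊖∣≤ a b c d eq with ≤-total a b
  ... | inj₁ a≤b = begin
    ℤ.∣ a ⊖ b ∣  ≡⟨ ℤ.∣⊖∣-≤ a≤b ⟩
    b ∸ a        ≤⟨ m≤n+o⇒m∸n≤o b a (≤-trans (m≤m+n b d) (≤-reflexive (sym eq))) ⟩
    c            ≤⟨ m≤n+m c d ⟩
    d + c        ∎
    where open ≤-Reasoning
  ... | inj₂ b≤a = begin
    ℤ.∣ a ⊖ b ∣  ≡⟨ cong ℤ.∣_∣ (ℤ.⊖-≥ b≤a) ⟩
    a ∸ b        ≤⟨ m≤n+o⇒m∸n≤o a b (≤-trans (m≤m+n a c) (≤-reflexive eq)) ⟩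
    d            ≤⟨ m≤m+n d c ⟩
    d + c        ∎
    where open ≤-Reasoning

  -- The exact formula concerns positive lengths, so the thresholds for the error terms have the
  -- form `suc n₀`. It bounds the deviation of G from c 2ⁿ by N + k.
  module _ (G N : ℕ → ℕ) (c k : ℕ)
    (exact : ∀ n → G (suc n) + k ≡ c * 2 ^ suc n + N (suc n))
    (negligible : Negligible (λ n → N n + k)) (G>0 : ∀ n → 0 < G n) (c>0 : 0 < c) where

    deviation : ℕ → ℤ
    deviation n = G n ⊖ c * 2 ^ n

    decomposition : ∀ n → + G n ≡ + c ℤ.* + (2 ^ n) ℤ.+ deviation n
    decomposition n = begin
      + G n                                     ≡⟨ ℤ.+-identityˡ (+ G n) ⟨
      + 0 ℤ.+ + G n                             ≡⟨ cong (ℤ._+ + G n) (ℤ.+-inverseʳ cd) ⟨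
      cd ℤ.- cd ℤ.+ + G n                       ≡⟨ ℤ.+-assoc cd (ℤ.- cd) (+ G n) ⟩
      cd ℤ.+ (ℤ.- cd ℤ.+ + G n)                 ≡⟨ cong (λ t → cd ℤ.+ t) (ℤ.+-comm (ℤ.- cd) (+ G n)) ⟩
      cd ℤ.+ (+ G n ℤ.- cd)                     ≡⟨ cong (λ t → cd ℤ.+ t) (ℤ.m-n≡m⊖n (G n) (c * 2 ^ n)) ⟩
      cd ℤ.+ deviation n                          ≡⟨ cong (ℤ._+ deviation n) (ℤ.pos-* c (2 ^ n)) ⟩
      + c ℤ.* + (2 ^ n) ℤ.+ deviation n           ∎
      where
      open ≡-Reasoning
      cd = + (c * 2 ^ n)

    first-error second-error : ℕ → ℚ
    first-error n = (deviation n ℚ./ 2 ^ n) {{m^n≢0 2 n}}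
    second-error n = (+ N n ℚ./ G n) {{>-nonZero (G>0 n)}}

    first-littleO : IsLittleO1 first-error
    first-littleO ε 0<ε with negligible (↧ₙ ε)
    ... | n₀ , small = suc n₀ , λ { (suc n) (s≤s n₀≤n) → ∣/∣<ε (deviation (suc n)) (2 ^ suc n) {{m^n≢0 2 (suc n)}} ε 0<ε (bound n n₀≤n) }
      where
      bound : ∀ n → n₀ ≤ n → ↧ₙ ε * ℤ.∣ deviation (suc n) ∣ < 2 ^ suc n
      bound n n₀≤n = ≤-<-trans
        (*-monoʳ-≤ (↧ₙ ε) (∣⊖∣≤ (G (suc n)) (c * 2 ^ suc n) k (N (suc n)) (exact n)))
        (small (suc n) (m≤n⇒m≤1+n n₀≤n))

    second-littleO : IsLittleO1 second-error
    second-littleO ε 0<ε with negligible (↧ₙ ε)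
    ... | n₀ , small = suc n₀ , λ { (suc n) (s≤s n₀≤n) → ∣/∣<ε (+ N (suc n)) (G (suc n)) {{>-nonZero (G>0 (suc n))}} ε 0<ε (bound n n₀≤n) }
      where
      open ≤-Reasoning
      q = ↧ₙ ε
      bound : ∀ n → n₀ ≤ n → q * N (suc n) < G (suc n)
      -- Adding `k` on both sides lets `exact` act as a lower bound for `G` without subtraction; on
      -- the left it is absorbed because q ≥ 1.
      bound n n₀≤n = +-cancelʳ-< k _ _ (begin-strict
        q * N (suc n) + k          ≤⟨ +-monoʳ-≤ (q * N (suc n)) (m≤n*m k q) ⟩
        q * N (suc n) + q * k      ≡⟨ *-distribˡ-+ q (N (suc n)) k ⟨
        q * (N (suc n) + k)        <⟨ small (suc n) (m≤n⇒m≤1+n n₀≤n) ⟩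
        2 ^ suc n                          ≤⟨ m≤n*m (2 ^ suc n) c {{>-nonZero c>0}} ⟩
        c * 2 ^ suc n                      ≤⟨ m≤m+n _ _ ⟩
        c * 2 ^ suc n + N (suc n)  ≡⟨ exact n ⟨
        G (suc n) + k                    ∎)

    asymptotics :
      (∃ λ (e : ℕ → ℚ) → IsLittleO1 e × (∀ n → fromℕ (G n) ≡ (fromℕ c ℚ.+ e n) ℚ.* fromℕ (2 ^ n)))
      × (∃ λ (e : ℕ → ℚ) → IsLittleO1 e × (∀ n → fromℕ (N n) ≡ e n ℚ.* fromℕ (G n)))
    asymptotics =
      (first-error , first-littleO , λ n → relative-error (G n) c (2 ^ n) (deviation n) {{m^n≢0 2 n}} (decomposition n)) ,
      (second-error , second-littleO , λ n → sym (/-*-cancel (+ N n) (G n) {{>-nonZero (G>0 n)}}))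

  [2+s]C2>0 : ∀ s → 0 < (2 + s) C 2
  [2+s]C2>0 s = n≢0⇒n>0 λ C≡0 → contradiction (trans (sym (2*[2+s]C2 s)) (cong (2 *_) C≡0)) λ ()

open Asymptotics

open import Data.Rational.Base using (ℚ; _+_; _*_)

corollary1p3 : ∀ (r : ℕ) → 3 ≤ r →
    (∃ λ (e : ℕ → ℚ) → IsLittleO1 e ×
    (∀ n → fromℕ (g r n) ≡ (fromℕ (r C 2) + e n) * fromℕ (2 ^ n)))
    ×
    (∃ λ (e : ℕ → ℚ) → IsLittleO1 e ×
    (∀ n → fromℕ (gNonTwo r n) ≡ e n * fromℕ (g r n)))
corollary1p3 (suc zero) (s≤s ())
-- Here r s = r (r - 2) is the correction for monochromatic colorings from `#twoColored`.
corollary1p3 r@(suc (suc s)) _ = asymptotics (g r) (gNonTwo r) (r C 2) (r Nat.* s)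
  (g-exact s) (gNonTwo-negligible r (r Nat.* s)) (g>0 (suc s)) ([2+s]C2>0 s)
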